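{- Let $a$ be an indeterminate and let $$ B=\begin{bmatrix} a&1&a&1\\ 1&0&1&a\\ 0&1&a&1\\ 1&a&1&a \end{bmatrix}. $$ Then for all $n\ge1$, $$M(AD_{2n};\mathrm{wt}_B)=(1+a^2)^{n(n+1)}.$$
   Context: For $n\ge0$, the Aztec diamond graph $AD_n$ has vertices $u_{i,j}$ ($0\le i\le n$, $1\le j\le n$) and $v_{i,j}$ ($1\le i\le n$, $0\le j\le n$), and $4n^2$ edges $\epsilon_{r,s}$, $1\le r,s\le 2n$ (the edge centers form a $2n\times2n$ array), where for $1\le i,j\le n$: $\epsilon_{2i-1,2j-1}=u_{i-1,j}v_{i,j-1}$, $\epsilon_{2i-1,2j}=u_{i-1,j}v_{i,j}$, $\epsilon_{2i,2j-1}=u_{i,j}v_{i,j-1}$, $\epsilon_{2i,2j}=u_{i,j}v_{i,j}$. For a $k\times l$ matrix $A$ with $k,l$ even, the weight $\mathrm{wt}_A$ on $AD_n$ assigns to the edge $\epsilon_{r,s}$ the entry of $A$ in row $r'$ and column $s'$, where $1\le r'\le k$, $r'\equiv r \pmod k$, $1\le s'\le l$, $s'\equiv s\pmod l$ (the array of edges is filled periodically with copies of $A$ starting from the upper left corner). The weight of a perfect matching is the product of the weights of its edges, and $M(G;\mathrm{wt})$ is the sum of the weights of all perfect matchings of $G$. -}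

module Defs where

open import Level using (Level)
open import Algebra.Bundles using (CommutativeRing)
open import Data.Nat.Base using (ℕ; suc; _*_; NonZero)
import Data.Nat.Properties as ℕ
open import Data.Nat.DivMod using (_mod_)
open import Data.Fin.Base using (Fin; suc; toℕ; inject₁; remQuot)
open import Data.Fin.Patterns using (0F; 1F)
import Data.Fin.Properties as Fin
open import Data.List.Base
  using (List; []; _∷_; _++_; map; filter; foldr; length; allFin; cartesianProduct)
open import Data.List.Membership.Propositional using (_∈_)
open import Data.List.Membership.Propositional.Properties
  using (∈-allFin; ∈-map⁺; ∈-++⁺ˡ; ∈-++⁺ʳ; ∈-cartesianProduct⁺)
import Data.List.Relation.Unary.All as All
open import Data.List.Relation.Unary.Unique.Propositional using (Unique)
open import Data.List.Relation.Unary.Unique.Propositional.Properties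
  using (allFin⁺; cartesianProduct⁺)
open import Data.Product.Base using (_×_; _,_; proj₁; proj₂)
open import Data.Sum.Base using (_⊎_)
open import Data.Vec.Base using (Vec; []; _∷_; lookup)
open import Relation.Binary.Definitions using (DecidableEquality)
open import Relation.Binary.PropositionalEquality.Core using (_≡_; refl; cong₂)
open import Relation.Nullary.Decidable using (no; map′; _×-dec_; _⊎-dec_)
open import Relation.Unary using (Decidable)

record FiniteGraph : Set₁ where
  field
    Vertex Edge  : Set
    endpoints    : Edge → Vertex × Vertex
    _≟_          : DecidableEquality Vertex
    vertices     : List Vertex
    vertices-all : ∀ x → x ∈ vertices
    edges        : List Edge
    edges-all    : ∀ e → e ∈ edges
    edges-unique : Unique edges

  Incident : Vertex → Edge → Set
  Incident x e = x ≡ proj₁ (endpoints e) ⊎ x ≡ proj₂ (endpoints e)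

  incident? : ∀ x → Decidable (Incident x)
  incident? x e = (x ≟ proj₁ (endpoints e)) ⊎-dec (x ≟ proj₂ (endpoints e))

  -- For a duplicate-free list S of edges, regarded as a set.
  IsPerfectMatching : List Edge → Set
  IsPerfectMatching S = ∀ x → length (filter (incident? x) S) ≡ 1

  isPerfectMatching? : Decidable IsPerfectMatching
  isPerfectMatching? S =
    map′ (λ all x → All.lookup all (vertices-all x)) (λ p → All.tabulate (λ {x} _ → p x))
         (All.all? (λ x → length (filter (incident? x) S) ℕ.≟ 1) vertices)

-- All sublists; when xs is duplicate-free these are the subsets of xs,
-- each listed exactly once.
sublists : {A : Set} → List A → List (List A)
sublists []       = [] ∷ []
sublists (x ∷ xs) = map (x ∷_) (sublists xs) ++ sublists xs

perfectMatchings : (G : FiniteGraph) → List (List (FiniteGraph.Edge G))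
perfectMatchings G = filter isPerfectMatching? (sublists edges)
  where open FiniteGraph G

module _ {c ℓ : Level} (R : CommutativeRing c ℓ) where
  open CommutativeRing R using (Carrier; 0#; 1#) renaming (_+_ to _+ᴿ_; _*_ to _*ᴿ_)

  matchingWeight : {E : Set} → (E → Carrier) → List E → Carrier
  matchingWeight wt S = foldr _*ᴿ_ 1# (map wt S)

  M : (G : FiniteGraph) → (FiniteGraph.Edge G → Carrier) → Carrier
  M G wt = foldr _+ᴿ_ 0# (map (matchingWeight wt) (perfectMatchings G))

-- Indices that run from 1 in the usual notation are shifted to run from 0 here;
-- those that run from 0 are unchanged.  Thus u i j is u_{i,j+1} and v i j is v_{i+1,j}.
data AztecVertex (n : ℕ) : Set where
  u : Fin (suc n) → Fin n → AztecVertex n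
  v : Fin n → Fin (suc n) → AztecVertex n

-- (r , s) is the edge ε_{r+1,s+1}.
AztecEdge : ℕ → Set
AztecEdge n = Fin (n * 2) × Fin (n * 2)

-- The arguments are the quotient and remainder by 2 of the 0-based row and column.
-- With i, j shifted down by one, the clauses are, in order,
--   ε_{2i-1,2j-1} = u_{i-1,j} v_{i,j-1}    ε_{2i-1,2j} = u_{i-1,j} v_{i,j}
--   ε_{2i,2j-1}   = u_{i,j}   v_{i,j-1}    ε_{2i,2j}   = u_{i,j}   v_{i,j}
aztecEnds : {n : ℕ} → Fin n × Fin 2 → Fin n × Fin 2 → AztecVertex n × AztecVertex n
aztecEnds (i , 0F) (j , 0F) = u (inject₁ i) j , v i (inject₁ j)
aztecEnds (i , 0F) (j , 1F) = u (inject₁ i) j , v i (suc j)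
aztecEnds (i , 1F) (j , 0F) = u (suc i) j     , v i (inject₁ j)
aztecEnds (i , 1F) (j , 1F) = u (suc i) j     , v i (suc j)

aztec-≟ : {n : ℕ} → DecidableEquality (AztecVertex n)
aztec-≟ (u i j) (u k l) =
  map′ (λ (p , q) → cong₂ u p q) (λ { refl → refl , refl }) ((i Fin.≟ k) ×-dec (j Fin.≟ l))
aztec-≟ (v i j) (v k l) =
  map′ (λ (p , q) → cong₂ v p q) (λ { refl → refl , refl }) ((i Fin.≟ k) ×-dec (j Fin.≟ l))
aztec-≟ (u _ _) (v _ _) = no λ ()
aztec-≟ (v _ _) (u _ _) = no λ ()

aztecVertices : (n : ℕ) → List (AztecVertex n)
aztecVertices n =
  map (λ (i , j) → u i j) (cartesianProduct (allFin (suc n)) (allFin n)) ++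
  map (λ (i , j) → v i j) (cartesianProduct (allFin n) (allFin (suc n)))

aztecVertices-all : {n : ℕ} (x : AztecVertex n) → x ∈ aztecVertices n
aztecVertices-all (u i j) =
  ∈-++⁺ˡ (∈-map⁺ _ (∈-cartesianProduct⁺ (∈-allFin i) (∈-allFin j)))
aztecVertices-all {n} (v i j) =
  ∈-++⁺ʳ (map (λ (i , j) → u i j) (cartesianProduct (allFin (suc n)) (allFin n)))
    (∈-map⁺ _ (∈-cartesianProduct⁺ (∈-allFin i) (∈-allFin j)))

AD : ℕ → FiniteGraph
AD n = record
  { Vertex       = AztecVertex n
  ; Edge         = AztecEdge n
  ; endpoints    = λ (r , s) → aztecEnds (remQuot 2 r) (remQuot 2 s)
  ; _≟_          = aztec-≟
  ; vertices     = aztecVertices n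
  ; vertices-all = aztecVertices-all
  ; edges        = cartesianProduct (allFin (n * 2)) (allFin (n * 2))
  ; edges-all    = λ (r , s) → ∈-cartesianProduct⁺ (∈-allFin r) (∈-allFin s)
  ; edges-unique = cartesianProduct⁺ (allFin⁺ (n * 2)) (allFin⁺ (n * 2))
  }

-- A is given by its rows.
periodicWeight : {c : Level} {X : Set c} {k l : ℕ} .{{_ : NonZero k}} .{{_ : NonZero l}} →
                 Vec (Vec X l) k → (n : ℕ) → AztecEdge n → X
periodicWeight {k = k} {l = l} A n (r , s) = lookup (lookup A (toℕ r mod k)) (toℕ s mod l)

module _ {c ℓ : Level} (R : CommutativeRing c ℓ) where
  open CommutativeRing R using (Carrier; 0#; 1#)

  B : Carrier → Vec (Vec Carrier 4) 4
  B a = (a  ∷ 1# ∷ a  ∷ 1# ∷ [])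
      ∷ (1# ∷ 0# ∷ 1# ∷ a  ∷ [])
      ∷ (0# ∷ 1# ∷ a  ∷ 1# ∷ [])
      ∷ (1# ∷ a  ∷ 1# ∷ a  ∷ [])
      ∷ []

module Submission where

-- A perfect matching of AD N is a state for each of the N² cells (the 4-cycles with edges
-- ε_{2i-1,2j-1}, ε_{2i-1,2j}, ε_{2i,2j-1}, ε_{2i,2j}), namely the set of vertices of the cell
-- that are matched inside it, such that every vertex is matched in exactly one of its cells.
-- Complementing the states of all cells turns these into the state families of AD (N - 1),
-- which sits inside AD N with the interior vertices only, and edges of a cell go to the
-- opposite ones.  If all cells of column j have the same weight Δ_j (the sum of the products
-- of opposite edges), the weights of a family and of its complement differ by ∏ Δ_j, because
-- down a column the exponents of Δ_j telescope; likewise for rows.  This is urban renewal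
-- without division, so it holds in every commutative ring. For B the cell weights are 1, 1 +
-- a², 1, … by columns; the weights on AD (2n - 1) so obtained have cell weights 1 + a², 1, 1 +
-- a², … by rows, and one more step returns to B.  Hence M(AD_{2n}) = (1 + a²)^{2n}
-- M(AD_{2n-2}).

open import Defs
open import Algebra.Bundles using (CommutativeRing)
open import Algebra.Properties.Semiring.Exp using ()
import Algebra.Solver.Ring.NaturalCoefficients.Default as RingSolver
open import Data.Bool.Base using (Bool; true; false; if_then_else_; _∧_; _∨_)
open import Data.Bool.Properties using (∨-identityʳ)
open import Data.Fin.Base as Fin
  using (Fin; zero; suc; toℕ; fromℕ<; inject₁; remQuot; combine)
open import Data.Fin.Patterns using (0F; 1F)
import Data.Fin.Properties as Fin
open import Data.List.Base
  using (List; []; _∷_; [_]; _++_; map; filter; foldr; length; tabulate; allFin; cartesianProduct)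
import Data.List.Properties as List
open import Data.List.Relation.Binary.Permutation.Propositional as Perm
  using (_↭_; prep; swap; ↭-refl; ↭-sym; ↭-trans; ↭-reflexive; module PermutationReasoning)
import Data.List.Relation.Binary.Permutation.Propositional.Properties as ↭
open import Data.List.Relation.Unary.All as All using (All; []; _∷_)
import Data.List.Relation.Unary.All.Properties as All
open import Data.Nat.Base as ℕ
  using (ℕ; zero; suc; _∸_; _≤_; _<_; _≥_; z≤n; s≤s; ⌊_/2⌋; ⌈_/2⌉)
open import Data.Nat.DivMod using (_mod_; _%_; [m+n]%n≡m%n; m%n<n)
import Data.Nat.Properties as ℕ
import Data.Nat.Solver
open import Data.Product.Base using (_×_; _,_; proj₁; uncurry)
open import Data.Sum.Base using (inj₁; inj₂)
open import Data.Vec.Base using (lookup)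
open import Function.Base using (_∘_; id)
open import Level as Level using (Level)
open import Relation.Binary.PropositionalEquality as ≡
  using (_≡_; _≢_; _≗_; cong; cong₂; subst; module ≡-Reasoning)
open import Relation.Nullary.Decidable using (Dec; yes; no; does; map′; _×-dec_; _⊎-dec_)
open import Relation.Nullary.Negation using (¬_; contradiction)

module _ where
  open import Data.Nat.Base using (_+_; _*_)
  open import Relation.Binary.PropositionalEquality using (refl)

  private variable
    ℓ : Level
    A C : Set ℓ

  -- Concatenations of finite families of lists, up to permutation

  concatUpTo : {A : Set ℓ} → ℕ → (ℕ → List A) → List A
  concatUpTo zero    f = []
  concatUpTo (suc n) f = f 0 ++ concatUpTo n (f ∘ suc)

  map-concatUpTo : (h : A → C) → ∀ n f → map h (concatUpTo n f) ≡ concatUpTo n (map h ∘ f)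
  map-concatUpTo h zero    f = refl
  map-concatUpTo h (suc n) f =
    ≡.trans (List.map-++ h (f 0) _) (cong (map h (f 0) ++_) (map-concatUpTo h n (f ∘ suc)))

  concatUpTo-cong : ∀ n {f g : ℕ → List A} → f ≗ g → concatUpTo n f ≡ concatUpTo n g
  concatUpTo-cong zero    f≗g = refl
  concatUpTo-cong (suc n) f≗g = cong₂ _++_ (f≗g 0) (concatUpTo-cong n (f≗g ∘ suc))

  concatUpTo-↭ : ∀ n {f g : ℕ → List A} → (∀ i → f i ↭ g i) → concatUpTo n f ↭ concatUpTo n g
  concatUpTo-↭ zero    f↭g = ↭-refl
  concatUpTo-↭ (suc n) f↭g = ↭.++⁺ (f↭g 0) (concatUpTo-↭ n (f↭g ∘ suc))

  concatUpTo-[] : {A : Set ℓ} → ∀ n → concatUpTo n (λ _ → []) ≡ ([] {A = A})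
  concatUpTo-[] zero    = refl
  concatUpTo-[] (suc n) = concatUpTo-[] n

  ++-interchange : (as bs cs ds : List A) → (as ++ bs) ++ (cs ++ ds) ↭ (as ++ cs) ++ (bs ++ ds)
  ++-interchange as bs cs ds = begin
    (as ++ bs) ++ (cs ++ ds)  ≡⟨ List.++-assoc as bs (cs ++ ds) ⟩
    as ++ (bs ++ (cs ++ ds))  ≡⟨ cong (as ++_) (List.++-assoc bs cs ds) ⟨
    as ++ ((bs ++ cs) ++ ds)  ↭⟨ ↭.++⁺ˡ as (↭.++⁺ʳ ds (↭.++-comm bs cs)) ⟩
    as ++ ((cs ++ bs) ++ ds)  ≡⟨ cong (as ++_) (List.++-assoc cs bs ds) ⟩
    as ++ (cs ++ (bs ++ ds))  ≡⟨ List.++-assoc as cs (bs ++ ds) ⟨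
    (as ++ cs) ++ (bs ++ ds)  ∎
    where open PermutationReasoning

  concatUpTo-++ : ∀ n (f g : ℕ → List A) →
                  concatUpTo n (λ i → f i ++ g i) ↭ concatUpTo n f ++ concatUpTo n g
  concatUpTo-++ zero    f g = ↭-refl
  concatUpTo-++ (suc n) f g =
    ↭-trans (↭.++⁺ˡ (f 0 ++ g 0) (concatUpTo-++ n (f ∘ suc) (g ∘ suc)))
            (++-interchange (f 0) (g 0) _ _)

  concatUpTo-swap : ∀ m n (f : ℕ → ℕ → List A) →
                    concatUpTo m (λ i → concatUpTo n (f i)) ↭
                    concatUpTo n (λ j → concatUpTo m (λ i → f i j))
  concatUpTo-swap zero    n f = ↭-reflexive (≡.sym (concatUpTo-[] n))
  concatUpTo-swap (suc m) n f =
    ↭-trans (↭.++⁺ˡ (concatUpTo n (f 0)) (concatUpTo-swap m n (f ∘ suc)))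
            (↭-sym (concatUpTo-++ n (f 0) _))

  concatUpTo-last : ∀ n (f : ℕ → List A) → concatUpTo (suc n) f ≡ concatUpTo n f ++ f n
  concatUpTo-last zero    f = List.++-identityʳ (f 0)
  concatUpTo-last (suc n) f =
    ≡.trans (cong (f 0 ++_) (concatUpTo-last n (f ∘ suc)))
            (≡.sym (List.++-assoc (f 0) (concatUpTo n (f ∘ suc)) (f (suc n))))

  concatUpTo-double : ∀ n (f : ℕ → List A) →
                      concatUpTo (n * 2) f ≡ concatUpTo n (λ i → f (i * 2) ++ f (suc (i * 2)))
  concatUpTo-double zero    f = refl
  concatUpTo-double (suc n) f =
    ≡.trans (cong (λ xs → f 0 ++ f 1 ++ xs) (concatUpTo-double n (λ i → f (2 + i))))
            (≡.sym (List.++-assoc (f 0) (f 1) _))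

  All-concatUpTo : ∀ {p} {P : A → Set p} n {f : ℕ → List A} →
                   (∀ i → All P (f i)) → All P (concatUpTo n f)
  All-concatUpTo zero    Pf = []
  All-concatUpTo (suc n) Pf = All.++⁺ (Pf 0) (All-concatUpTo n (Pf ∘ suc))

  map-cartesianProduct : {A B : Set} (h : A × B → C) (xs : List A) (ys : List B) →
                         map h (cartesianProduct xs ys) ≡
                         foldr (λ x zs → map (λ y → h (x , y)) ys ++ zs) [] xs
  map-cartesianProduct h []       ys = refl
  map-cartesianProduct h (x ∷ xs) ys =
    ≡.trans (List.map-++ h (map (x ,_) ys) _)
            (cong₂ _++_ (≡.sym (List.map-∘ ys)) (map-cartesianProduct h xs ys))

  tabulate-concatUpTo : ∀ n (f : ℕ → A) → tabulate {n = n} (f ∘ toℕ) ≡ concatUpTo n (λ i → [ f i ])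
  tabulate-concatUpTo zero    f = refl
  tabulate-concatUpTo (suc n) f = cong (f 0 ∷_) (tabulate-concatUpTo n (f ∘ suc))

  foldr-tabulate-concatUpTo : {X : Set} → ∀ n (f : ℕ → List A) {k : Fin n → X} (h : X → List A) →
    (∀ i → h (k i) ≡ f (toℕ i)) →
    foldr (λ x zs → h x ++ zs) [] (tabulate k) ≡ concatUpTo n f
  foldr-tabulate-concatUpTo zero    f h eq = refl
  foldr-tabulate-concatUpTo (suc n) f h eq =
    cong₂ _++_ (eq zero) (foldr-tabulate-concatUpTo n (f ∘ suc) h (λ i → eq (suc i)))

  -- Passes from the edge list of `AD`, a product of `allFin`s, to arrays indexed by natural
  -- numbers, where halves, shifts and last rows need no `Fin` arithmetic.
  map-allFin² : ∀ n (f : ℕ → ℕ → A) →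
    map (λ (r , s) → f (toℕ r) (toℕ s)) (cartesianProduct (allFin n) (allFin n)) ≡
    concatUpTo n (λ r → concatUpTo n (λ s → [ f r s ]))
  map-allFin² n f =
    ≡.trans (map-cartesianProduct _ (allFin n) (allFin n))
            (foldr-tabulate-concatUpTo n _ _ λ r →
               ≡.trans (List.map-tabulate id _) (tabulate-concatUpTo n (f (toℕ r))))

  -- Kronecker symbols and the coordinates of the Aztec diamond

  δ : ℕ → ℕ → ℕ
  δ zero    zero    = 1
  δ zero    (suc _) = 0
  δ (suc _) zero    = 0
  δ (suc m) (suc n) = δ m n

  δ-refl : ∀ n → δ n n ≡ 1
  δ-refl zero    = refl
  δ-refl (suc n) = δ-refl n

  δ-< : ∀ {m n} → m < n → δ m n ≡ 0
  δ-< {zero}  (s≤s _)   = refl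
  δ-< {suc m} (s≤s m<n) = δ-< m<n

  -- The Iverson bracket, with the recursion of `δ` in both arguments so that `∑ℕ-δ` is a plain
  -- induction.
  ⟦_<_⟧ : ℕ → ℕ → ℕ
  ⟦ _     < zero  ⟧ = 0
  ⟦ zero  < suc n ⟧ = 1
  ⟦ suc k < suc n ⟧ = ⟦ k < n ⟧

  <⇒⟦<⟧≡1 : ∀ {k n} → k < n → ⟦ k < n ⟧ ≡ 1
  <⇒⟦<⟧≡1 {zero}  {suc n} _         = refl
  <⇒⟦<⟧≡1 {suc k} {suc n} (s≤s k<n) = <⇒⟦<⟧≡1 k<n

  ⟦n<n⟧≡0 : ∀ n → ⟦ n < n ⟧ ≡ 0
  ⟦n<n⟧≡0 zero    = refl
  ⟦n<n⟧≡0 (suc n) = ⟦n<n⟧≡0 n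

  ⟦<⟧≤1 : ∀ k n → ⟦ k < n ⟧ ≤ 1
  ⟦<⟧≤1 k       zero    = z≤n
  ⟦<⟧≤1 zero    (suc n) = s≤s z≤n
  ⟦<⟧≤1 (suc k) (suc n) = ⟦<⟧≤1 k n

  ⌊m*2/2⌋≡m : ∀ m → ⌊ m * 2 /2⌋ ≡ m
  ⌊m*2/2⌋≡m zero    = refl
  ⌊m*2/2⌋≡m (suc m) = cong suc (⌊m*2/2⌋≡m m)

  ⌈m*2/2⌉≡m : ∀ m → ⌈ m * 2 /2⌉ ≡ m
  ⌈m*2/2⌉≡m zero    = refl
  ⌈m*2/2⌉≡m (suc m) = cong suc (⌈m*2/2⌉≡m m)

  ⌊/2⌋-< : ∀ {m n} → m < n * 2 → ⌊ m /2⌋ < n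
  ⌊/2⌋-< {zero}        {suc n} _               = s≤s z≤n
  ⌊/2⌋-< {suc zero}    {suc n} _               = s≤s z≤n
  ⌊/2⌋-< {suc (suc m)} {suc n} (s≤s (s≤s m<n)) = s≤s (⌊/2⌋-< m<n)

  -- U i j and V i j stand for the vertices u i j and v i j of every AD N containing them.
  data Vertex : Set where
    U V : ℕ → ℕ → Vertex

  _∈AD_ : Vertex → ℕ → Set
  U k l ∈AD N = k < suc N × l < N
  V k l ∈AD N = k < N × l < suc N

  Degrees : Set
  Degrees = Vertex → ℕ

  ∅ : Degrees
  ∅ _ = 0

  infixl 6 _⊕_
  _⊕_ : Degrees → Degrees → Degrees
  (g ⊕ h) x = g x + h x

  -- With 0-based indices the edge in row `r` and column `s` joins `U ⌈ r /2⌉ ⌊ s /2⌋` to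
  -- `V ⌊ r /2⌋ ⌈ s /2⌉`; the rounding replaces the parity cases of `aztecEnds`.
  edgeInc : ℕ → ℕ → Degrees
  edgeInc r s (U k l) = δ ⌈ r /2⌉ k * δ ⌊ s /2⌋ l
  edgeInc r s (V k l) = δ ⌊ r /2⌋ k * δ ⌈ s /2⌉ l

  Balanced : ℕ → Degrees → Degrees → Set
  Balanced N t g = ∀ x → x ∈AD N → g x ≡ t x

  balanced? : ∀ N t g → Dec (Balanced N t g)
  balanced? N t g =
    map′ (λ { (p , q) (U k l) (k< , l<) → p k< l< ; (p , q) (V k l) (k< , l<) → q k< l< })
         (λ p → (λ {k} k< {l} l< → p (U k l) (k< , l<)) , (λ {k} k< {l} l< → p (V k l) (k< , l<)))
         (ℕ.allUpTo? (λ k → ℕ.allUpTo? (λ l → g (U k l) ℕ.≟ t (U k l)) N) (suc N) ×-dec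
          ℕ.allUpTo? (λ k → ℕ.allUpTo? (λ l → g (V k l) ℕ.≟ t (V k l)) (suc N)) N)

  𝟏 : Degrees
  𝟏 _ = 1

  -- The target degrees of the matchings of the inner AD (N - 1): 1 on its vertices, 0 on the
  -- boundary of AD N.
  inner : ℕ → Degrees
  inner N (U zero    l) = 0
  inner N (U (suc k) l) = ⟦ suc k < N ⟧
  inner N (V k zero)    = 0
  inner N (V k (suc l)) = ⟦ suc l < N ⟧

  inner≤1 : ∀ N x → inner N x ≤ 1
  inner≤1 N (U zero    l) = z≤n
  inner≤1 N (U (suc k) l) = ⟦<⟧≤1 (suc k) N
  inner≤1 N (V k zero)    = z≤n
  inner≤1 N (V k (suc l)) = ⟦<⟧≤1 (suc l) N

  -- The vertex of AD (N + 1) at which AD N has the vertex x, when its edge array is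
  -- the inner part of that of AD (N + 1).
  shift : Vertex → Vertex
  shift (U k l) = V k (suc l)
  shift (V k l) = U (suc k) l

  -- Adding 1 to an index turns its lower half into its upper half, and its upper half into its
  -- lower half plus 1. This is why `shift` exchanges `U` and `V` and raises one coordinate.
  edgeInc-shift : ∀ r s x → edgeInc (suc r) (suc s) (shift x) ≡ edgeInc r s x
  edgeInc-shift r s (U k l) = refl
  edgeInc-shift r s (V k l) = refl

  -- Perfect matchings as edge sets with prescribed degrees

  bit : Bool → ℕ
  bit b = if b then 1 else 0

  position : ∀ {N} → AztecVertex N → Vertex
  position (u i j) = U (toℕ i) (toℕ j)
  position (v i j) = V (toℕ i) (toℕ j)

  position-∈AD : ∀ {N} (x : AztecVertex N) → position x ∈AD N
  position-∈AD (u i j) = Fin.toℕ<n i , Fin.toℕ<n j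
  position-∈AD (v i j) = Fin.toℕ<n i , Fin.toℕ<n j

  vertexAt : ∀ {N} x → x ∈AD N → AztecVertex N
  vertexAt (U k l) (k< , l<) = u (fromℕ< k<) (fromℕ< l<)
  vertexAt (V k l) (k< , l<) = v (fromℕ< k<) (fromℕ< l<)

  position-vertexAt : ∀ {N} x (x∈ : x ∈AD N) → position (vertexAt x x∈) ≡ x
  position-vertexAt (U k l) (k< , l<) = cong₂ U (Fin.toℕ-fromℕ< k<) (Fin.toℕ-fromℕ< l<)
  position-vertexAt (V k l) (k< , l<) = cong₂ V (Fin.toℕ-fromℕ< k<) (Fin.toℕ-fromℕ< l<)

  bit-≟ : ∀ {n} (i j : Fin n) → bit (does (i Fin.≟ j)) ≡ δ (toℕ j) (toℕ i)
  bit-≟ zero    zero    = refl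
  bit-≟ zero    (suc j) = refl
  bit-≟ (suc i) zero    = refl
  bit-≟ (suc i) (suc j) = bit-≟ i j

  bit-∧ : ∀ b c → bit (b ∧ c) ≡ bit b * bit c
  bit-∧ false c = refl
  bit-∧ true  c = ≡.sym (ℕ.+-identityʳ (bit c))

  endsInc : ∀ {N} → AztecVertex N × AztecVertex N → AztecVertex N → ℕ
  endsInc (p , q) x = bit (does (aztec-≟ x p ⊎-dec aztec-≟ x q))

  endsInc-u : ∀ {N} (i k : Fin (suc N)) (j l : Fin N) i′ j′ →
              endsInc (u i j , v i′ j′) (u k l) ≡ δ (toℕ i) (toℕ k) * δ (toℕ j) (toℕ l)
  endsInc-u i k j l _ _ = begin
    bit ((does (k Fin.≟ i) ∧ does (l Fin.≟ j)) ∨ false)  ≡⟨ cong bit (∨-identityʳ _) ⟩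
    bit (does (k Fin.≟ i) ∧ does (l Fin.≟ j))            ≡⟨ bit-∧ (does (k Fin.≟ i)) _ ⟩
    bit (does (k Fin.≟ i)) * bit (does (l Fin.≟ j))      ≡⟨ cong₂ _*_ (bit-≟ k i) (bit-≟ l j) ⟩
    δ (toℕ i) (toℕ k) * δ (toℕ j) (toℕ l)                ∎
    where open ≡-Reasoning

  endsInc-v : ∀ {N} (i k : Fin N) (j l : Fin (suc N)) i′ j′ →
              endsInc (u i′ j′ , v i j) (v k l) ≡ δ (toℕ i) (toℕ k) * δ (toℕ j) (toℕ l)
  endsInc-v i k j l _ _ =
    ≡.trans (bit-∧ (does (k Fin.≟ i)) _) (cong₂ _*_ (bit-≟ k i) (bit-≟ l j))

  toℕ-combine-0F : ∀ {n} (q : Fin n) → toℕ (combine {n = 2} q 0F) ≡ toℕ q * 2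
  toℕ-combine-0F q =
    ≡.trans (Fin.toℕ-combine {n = 2} q 0F) (≡.trans (ℕ.+-identityʳ _) (ℕ.*-comm 2 (toℕ q)))

  toℕ-combine-1F : ∀ {n} (q : Fin n) → toℕ (combine {n = 2} q 1F) ≡ suc (toℕ q * 2)
  toℕ-combine-1F q =
    ≡.trans (Fin.toℕ-combine {n = 2} q 1F) (≡.trans (ℕ.+-comm _ 1) (cong suc (ℕ.*-comm 2 (toℕ q))))

  ⌊combine/2⌋ : ∀ {n} (q : Fin n) (b : Fin 2) → ⌊ toℕ (combine q b) /2⌋ ≡ toℕ q
  ⌊combine/2⌋ q 0F = ≡.trans (cong ⌊_/2⌋ (toℕ-combine-0F q)) (⌊m*2/2⌋≡m (toℕ q))
  ⌊combine/2⌋ q 1F = ≡.trans (cong ⌊_/2⌋ (toℕ-combine-1F q)) (⌈m*2/2⌉≡m (toℕ q))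

  ⌈combine/2⌉ : ∀ {n} (q : Fin n) (b : Fin 2) → ⌈ toℕ (combine q b) /2⌉ ≡ toℕ b + toℕ q
  ⌈combine/2⌉ q 0F = ≡.trans (cong ⌈_/2⌉ (toℕ-combine-0F q)) (⌈m*2/2⌉≡m (toℕ q))
  ⌈combine/2⌉ q 1F = ≡.trans (cong ⌈_/2⌉ (toℕ-combine-1F q)) (cong suc (⌊m*2/2⌋≡m (toℕ q)))

  endsInc-aztecEnds : ∀ {N} (q : Fin N) b (q′ : Fin N) b′ x →
    endsInc (aztecEnds (q , b) (q′ , b′)) x ≡
    edgeInc (toℕ (combine q b)) (toℕ (combine q′ b′)) (position x)
  endsInc-aztecEnds q b q′ b′ (u k l)
    rewrite ⌈combine/2⌉ q b | ⌊combine/2⌋ q′ b′ = helper b b′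
    where
    helper : ∀ b b′ → endsInc (aztecEnds (q , b) (q′ , b′)) (u k l) ≡
                      δ (toℕ b + toℕ q) (toℕ k) * δ (toℕ q′) (toℕ l)
    helper 0F 0F rewrite ≡.sym (Fin.toℕ-inject₁ q) = endsInc-u (inject₁ q) k q′ l q (inject₁ q′)
    helper 0F 1F rewrite ≡.sym (Fin.toℕ-inject₁ q) = endsInc-u (inject₁ q) k q′ l q (suc q′)
    helper 1F 0F = endsInc-u (suc q) k q′ l q (inject₁ q′)
    helper 1F 1F = endsInc-u (suc q) k q′ l q (suc q′)
  endsInc-aztecEnds q b q′ b′ (v k l)
    rewrite ⌊combine/2⌋ q b | ⌈combine/2⌉ q′ b′ = helper b b′
    where
    helper : ∀ b b′ → endsInc (aztecEnds (q , b) (q′ , b′)) (v k l) ≡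
                      δ (toℕ q) (toℕ k) * δ (toℕ b′ + toℕ q′) (toℕ l)
    helper 0F 0F rewrite ≡.sym (Fin.toℕ-inject₁ q′) = endsInc-v q k (inject₁ q′) l (inject₁ q) q′
    helper 0F 1F = endsInc-v q k (suc q′) l (inject₁ q) q′
    helper 1F 0F rewrite ≡.sym (Fin.toℕ-inject₁ q′) = endsInc-v q k (inject₁ q′) l (suc q) q′
    helper 1F 1F = endsInc-v q k (suc q′) l (suc q) q′

  aztecInc : ∀ {m} → Fin m × Fin m → Degrees
  aztecInc (r , s) = edgeInc (toℕ r) (toℕ s)

  innerInc : ∀ {m} → Fin m × Fin m → Degrees
  innerInc (r , s) = edgeInc (suc (toℕ r)) (suc (toℕ s))

  -- The decision computes to `endsInc`, and every edge index is the `combine` of its quotient and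
  -- remainder by 2.
  bit-incident? : ∀ {N} (x : AztecVertex N) (e : AztecEdge N) →
                  bit (does (FiniteGraph.incident? (AD N) x e)) ≡ aztecInc e (position x)
  bit-incident? {N} x (r , s) =
    ≡.trans (endsInc-aztecEnds (proj₁ (remQuot {N} 2 r)) _ (proj₁ (remQuot {N} 2 s)) _ x)
            (cong₂ (λ r s → edgeInc (toℕ r) (toℕ s) (position x))
                   (Fin.combine-remQuot {N} 2 r) (Fin.combine-remQuot {N} 2 s))

  degrees : {E : Set} → (E → Degrees) → List E → Degrees
  degrees inc = foldr (λ e → inc e ⊕_) ∅

  length-filter-incident? : ∀ {N} (x : AztecVertex N) (S : List (AztecEdge N)) →
    length (filter (FiniteGraph.incident? (AD N) x) S) ≡ degrees aztecInc S (position x)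
  length-filter-incident? x [] = refl
  length-filter-incident? {N} x (e ∷ S)
    with does (FiniteGraph.incident? (AD N) x e) | bit-incident? x e
  ... | true  | eq = cong₂ _+_ eq (length-filter-incident? x S)
  ... | false | eq = cong₂ _+_ eq (length-filter-incident? x S)

  matching⇒balanced : ∀ {N} (S : List (AztecEdge N)) →
    FiniteGraph.IsPerfectMatching (AD N) S → Balanced N 𝟏 (degrees aztecInc S)
  matching⇒balanced S pm x x∈ = subst (λ y → degrees aztecInc S y ≡ 1) (position-vertexAt x x∈)
    (≡.trans (≡.sym (length-filter-incident? (vertexAt x x∈) S)) (pm (vertexAt x x∈)))

  balanced⇒matching : ∀ {N} (S : List (AztecEdge N)) →
    Balanced N 𝟏 (degrees aztecInc S) → FiniteGraph.IsPerfectMatching (AD N) S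
  balanced⇒matching S bal x =
    ≡.trans (length-filter-incident? x S) (bal (position x) (position-∈AD x))

  degrees-shift : ∀ {m} (S : List (Fin m × Fin m)) x →
                  degrees innerInc S (shift x) ≡ degrees aztecInc S x
  degrees-shift []            x = refl
  degrees-shift ((r , s) ∷ S) x =
    cong₂ _+_ (edgeInc-shift (toℕ r) (toℕ s) x) (degrees-shift S x)

  degrees-zero : {E : Set} {inc : E → Degrees} (S : List E) {x : Vertex} →
                 (∀ e → inc e x ≡ 0) → degrees inc S x ≡ 0
  degrees-zero []      inc≡0 = refl
  degrees-zero (e ∷ S) inc≡0 = cong₂ _+_ (inc≡0 e) (degrees-zero S inc≡0)

  -- A vertex of `AD (suc N)` is either a shifted vertex of `AD N`, with the same degree there, or
  -- on the boundary, which no inner edge reaches.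
  aztecBalanced⇒innerBalanced : ∀ {N} (S : List (AztecEdge N)) →
    Balanced N 𝟏 (degrees aztecInc S) → Balanced (suc N) (inner (suc N)) (degrees innerInc S)
  aztecBalanced⇒innerBalanced {N} S bal (U zero l) _ = degrees-zero S λ _ → refl
  aztecBalanced⇒innerBalanced {N} S bal (U (suc k) l) (s≤s k<1+N , l<)
    with ℕ.m<1+n⇒m<n∨m≡n k<1+N
  ... | inj₁ k<N = ≡.trans (degrees-shift S (V k l))
                           (≡.trans (bal (V k l) (k<N , l<)) (≡.sym (<⇒⟦<⟧≡1 k<N)))
  -- The bottom boundary: here `k` is `N`, while rows of `AD N` have `r < N * 2`, so their lower
  -- halves stay below `N`.
  ... | inj₂ refl = ≡.trans (degrees-zero S λ (r , s) →
                               cong (_* δ ⌈ toℕ s /2⌉ l) (δ-< (⌊/2⌋-< (Fin.toℕ<n r))))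
                            (≡.sym (⟦n<n⟧≡0 k))
  aztecBalanced⇒innerBalanced {N} S bal (V k zero) _ =
    degrees-zero S λ (r , s) → ℕ.*-zeroʳ (δ ⌈ toℕ r /2⌉ k)
  aztecBalanced⇒innerBalanced {N} S bal (V k (suc l)) (k< , s≤s l<1+N)
    with ℕ.m<1+n⇒m<n∨m≡n l<1+N
  ... | inj₁ l<N = ≡.trans (degrees-shift S (U k l))
                           (≡.trans (bal (U k l) (k< , l<N)) (≡.sym (<⇒⟦<⟧≡1 l<N)))
  ... | inj₂ refl = ≡.trans (degrees-zero S λ (r , s) →
                               ≡.trans (cong (δ ⌈ toℕ r /2⌉ k *_) (δ-< (⌊/2⌋-< (Fin.toℕ<n s))))
                                       (ℕ.*-zeroʳ (δ ⌈ toℕ r /2⌉ k)))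
                            (≡.sym (⟦n<n⟧≡0 l))

  innerBalanced⇒aztecBalanced : ∀ {N} (S : List (AztecEdge N)) →
    Balanced (suc N) (inner (suc N)) (degrees innerInc S) → Balanced N 𝟏 (degrees aztecInc S)
  innerBalanced⇒aztecBalanced {N} S bal (U k l) (k< , l<) =
    ≡.trans (≡.sym (degrees-shift S (U k l)))
            (≡.trans (bal (V k (suc l)) (k< , s≤s (ℕ.m<n⇒m<1+n l<))) (<⇒⟦<⟧≡1 l<))
  innerBalanced⇒aztecBalanced {N} S bal (V k l) (k< , l<) =
    ≡.trans (≡.sym (degrees-shift S (V k l)))
            (≡.trans (bal (U (suc k) l) (s≤s (ℕ.m<n⇒m<1+n k<) , l<)) (<⇒⟦<⟧≡1 k<))

  -- States of a cell

  -- The set of vertices of a cell that are covered by its own edges, for the sets that can occur;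
  -- nw, …, se are the ends of one edge.
  data State : Set where
    none nw ne sw se full : State

  states : List State
  states = none ∷ nw ∷ ne ∷ sw ∷ se ∷ full ∷ []

  co : State → State
  co none = full
  co nw   = se
  co ne   = sw
  co sw   = ne
  co se   = nw
  co full = none

  top bottom left right : State → ℕ
  top none = 0
  top nw   = 1
  top ne   = 1
  top sw   = 0
  top se   = 0
  top full = 1
  bottom none = 0
  bottom nw   = 0
  bottom ne   = 0
  bottom sw   = 1
  bottom se   = 1
  bottom full = 1
  left none = 0
  left nw   = 1
  left ne   = 0
  left sw   = 1
  left se   = 0
  left full = 1
  right none = 0
  right nw   = 0
  right ne   = 1
  right sw   = 0
  right se   = 1
  right full = 1

  -- The top and bottom vertices of the cell are `U i j` and `U (suc i) j`, the left and right ones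
  -- `V i j` and `V i (suc j)`. The factored form is the one that the telescoping along rows and
  -- columns uses.
  cellInc : ℕ → ℕ → State → Degrees
  cellInc i j T (U k l) = (δ i k * top T + δ (suc i) k * bottom T) * δ j l
  cellInc i j T (V k l) = δ i k * (δ j l * left T + δ (suc j) l * right T)

  record _⊎_≐_ (S T W : State) : Set where
    field
      top-+    : top S + top T ≡ top W
      bottom-+ : bottom S + bottom T ≡ bottom W
      left-+   : left S + left T ≡ left W
      right-+  : right S + right T ≡ right W

  pattern disjoint = record { top-+ = refl ; bottom-+ = refl ; left-+ = refl ; right-+ = refl }

  T⊎coT : ∀ T → T ⊎ co T ≐ full
  T⊎coT none = disjoint
  T⊎coT nw   = disjoint
  T⊎coT ne   = disjoint
  T⊎coT sw   = disjoint
  T⊎coT se   = disjoint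
  T⊎coT full = disjoint

  cellInc-⊎ : ∀ {S T W} → S ⊎ T ≐ W → ∀ i j → cellInc i j S ⊕ cellInc i j T ≗ cellInc i j W
  cellInc-⊎ {S} {T} S⊎T i j (U k l)
    rewrite ≡.sym (_⊎_≐_.top-+ S⊎T) | ≡.sym (_⊎_≐_.bottom-+ S⊎T) =
    solve 7 (λ a b d s t s′ t′ → (a :* s :+ b :* t) :* d :+ (a :* s′ :+ b :* t′) :* d :=
                                 (a :* (s :+ s′) :+ b :* (t :+ t′)) :* d) refl
      (δ i k) (δ (suc i) k) (δ j l) (top S) (bottom S) (top T) (bottom T)
    where open Data.Nat.Solver.+-*-Solver
  cellInc-⊎ {S} {T} S⊎T i j (V k l)
    rewrite ≡.sym (_⊎_≐_.left-+ S⊎T) | ≡.sym (_⊎_≐_.right-+ S⊎T) =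
    solve 7 (λ a b d s t s′ t′ → d :* (a :* s :+ b :* t) :+ d :* (a :* s′ :+ b :* t′) :=
                                 d :* (a :* (s :+ s′) :+ b :* (t :+ t′))) refl
      (δ j l) (δ (suc j) l) (δ i k) (left S) (right S) (left T) (right T)
    where open Data.Nat.Solver.+-*-Solver

  δ-suc : ∀ n → δ (suc n) n ≡ 0
  δ-suc zero    = refl
  δ-suc (suc n) = δ-suc n

  m*1+n*0≡m : ∀ m n → m * 1 + n * 0 ≡ m
  m*1+n*0≡m m n = ≡.trans (cong₂ _+_ (ℕ.*-identityʳ m) (ℕ.*-zeroʳ n)) (ℕ.+-identityʳ m)

  m*0+n*1≡n : ∀ m n → m * 0 + n * 1 ≡ n
  m*0+n*1≡n m n = cong₂ _+_ (ℕ.*-zeroʳ m) (ℕ.*-identityʳ n)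

  edgeInc-nw : ∀ i j → edgeInc (i * 2) (j * 2) ≗ cellInc i j nw
  edgeInc-nw i j (U k l) rewrite ⌈m*2/2⌉≡m i | ⌊m*2/2⌋≡m j =
    cong (_* δ j l) (≡.sym (m*1+n*0≡m (δ i k) (δ (suc i) k)))
  edgeInc-nw i j (V k l) rewrite ⌊m*2/2⌋≡m i | ⌈m*2/2⌉≡m j =
    cong (δ i k *_) (≡.sym (m*1+n*0≡m (δ j l) (δ (suc j) l)))

  edgeInc-ne : ∀ i j → edgeInc (i * 2) (suc (j * 2)) ≗ cellInc i j ne
  edgeInc-ne i j (U k l) rewrite ⌈m*2/2⌉≡m i | ⌈m*2/2⌉≡m j =
    cong (_* δ j l) (≡.sym (m*1+n*0≡m (δ i k) (δ (suc i) k)))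
  edgeInc-ne i j (V k l) rewrite ⌊m*2/2⌋≡m i | ⌊m*2/2⌋≡m j =
    cong (δ i k *_) (≡.sym (m*0+n*1≡n (δ j l) (δ (suc j) l)))

  edgeInc-sw : ∀ i j → edgeInc (suc (i * 2)) (j * 2) ≗ cellInc i j sw
  edgeInc-sw i j (U k l) rewrite ⌊m*2/2⌋≡m i | ⌊m*2/2⌋≡m j =
    cong (_* δ j l) (≡.sym (m*0+n*1≡n (δ i k) (δ (suc i) k)))
  edgeInc-sw i j (V k l) rewrite ⌈m*2/2⌉≡m i | ⌈m*2/2⌉≡m j =
    cong (δ i k *_) (≡.sym (m*1+n*0≡m (δ j l) (δ (suc j) l)))

  edgeInc-se : ∀ i j → edgeInc (suc (i * 2)) (suc (j * 2)) ≗ cellInc i j se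
  edgeInc-se i j (U k l) rewrite ⌊m*2/2⌋≡m i | ⌈m*2/2⌉≡m j =
    cong (_* δ j l) (≡.sym (m*0+n*1≡n (δ i k) (δ (suc i) k)))
  edgeInc-se i j (V k l) rewrite ⌈m*2/2⌉≡m i | ⌊m*2/2⌋≡m j =
    cong (δ i k *_) (≡.sym (m*0+n*1≡n (δ j l) (δ (suc j) l)))

  cellInc-top : ∀ i j T → cellInc i j T (U i j) ≡ top T
  cellInc-top i j T rewrite δ-refl i | δ-refl j | δ-suc i =
    solve 1 (λ t → (con 1 :* t :+ con 0) :* con 1 := t) refl (top T)
    where open Data.Nat.Solver.+-*-Solver

  cellInc-left : ∀ i j T → cellInc i j T (V i j) ≡ left T
  cellInc-left i j T rewrite δ-refl i | δ-refl j | δ-suc j =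
    solve 1 (λ t → con 1 :* (con 1 :* t :+ con 0) := t) refl (left T)
    where open Data.Nat.Solver.+-*-Solver

  δ-suc′ : ∀ n → δ n (suc n) ≡ 0
  δ-suc′ zero    = refl
  δ-suc′ (suc n) = δ-suc′ n

  cellInc-bottom : ∀ i j T → cellInc i j T (U (suc i) j) ≡ bottom T
  cellInc-bottom i j T rewrite δ-refl i | δ-refl j | δ-suc′ i =
    solve 1 (λ t → (con 0 :+ con 1 :* t) :* con 1 := t) refl (bottom T)
    where open Data.Nat.Solver.+-*-Solver

  cellInc-right : ∀ i j T → cellInc i j T (V i (suc j)) ≡ right T
  cellInc-right i j T rewrite δ-refl i | δ-refl j | δ-suc′ j =
    solve 1 (λ t → con 1 :* (con 0 :+ con 1 :* t) := t) refl (right T)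
    where open Data.Nat.Solver.+-*-Solver

  -- Number of cells at each vertex

  cells : ℕ → List (ℕ × ℕ)
  cells N = concatUpTo N λ i → concatUpTo N λ j → [ i , j ]

  totalInc : List (ℕ × ℕ) → Degrees
  totalInc = foldr (λ (i , j) → cellInc i j full ⊕_) ∅

  ∑ℕ : ℕ → (ℕ → ℕ) → ℕ
  ∑ℕ zero    f = 0
  ∑ℕ (suc n) f = f 0 + ∑ℕ n (f ∘ suc)

  ∑ℕ-cong : ∀ n {f g} → f ≗ g → ∑ℕ n f ≡ ∑ℕ n g
  ∑ℕ-cong zero    f≗g = refl
  ∑ℕ-cong (suc n) f≗g = cong₂ _+_ (f≗g 0) (∑ℕ-cong n (f≗g ∘ suc))

  ∑ℕ-+ : ∀ n f g → ∑ℕ n (λ i → f i + g i) ≡ ∑ℕ n f + ∑ℕ n g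
  ∑ℕ-+ zero    f g = refl
  ∑ℕ-+ (suc n) f g rewrite ∑ℕ-+ n (f ∘ suc) (g ∘ suc) =
    solve 4 (λ a b c d → (a :+ b) :+ (c :+ d) := (a :+ c) :+ (b :+ d)) refl
      (f 0) (g 0) (∑ℕ n (f ∘ suc)) (∑ℕ n (g ∘ suc))
    where open Data.Nat.Solver.+-*-Solver

  ∑ℕ-*ˡ : ∀ n m f → ∑ℕ n (λ i → m * f i) ≡ m * ∑ℕ n f
  ∑ℕ-*ˡ zero    m f = ≡.sym (ℕ.*-zeroʳ m)
  ∑ℕ-*ˡ (suc n) m f =
    ≡.trans (cong (m * f 0 +_) (∑ℕ-*ˡ n m (f ∘ suc))) (≡.sym (ℕ.*-distribˡ-+ m (f 0) _))

  ∑ℕ-*ʳ : ∀ n m f → ∑ℕ n (λ i → f i * m) ≡ ∑ℕ n f * m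
  ∑ℕ-*ʳ n m f = ≡.trans (∑ℕ-cong n λ i → ℕ.*-comm (f i) m)
                        (≡.trans (∑ℕ-*ˡ n m f) (ℕ.*-comm m _))

  ∑ℕ-0 : ∀ n → ∑ℕ n (λ _ → 0) ≡ 0
  ∑ℕ-0 zero    = refl
  ∑ℕ-0 (suc n) = ∑ℕ-0 n

  ∑ℕ-δ : ∀ n k → ∑ℕ n (λ i → δ i k) ≡ ⟦ k < n ⟧
  ∑ℕ-δ zero    k       = refl
  ∑ℕ-δ (suc n) zero    = cong suc (∑ℕ-0 n)
  ∑ℕ-δ (suc n) (suc k) = ∑ℕ-δ n k

  -- The line of vertices at height `k` bounds the cell rows `k` and `k - 1`; both exist unless `k`
  -- is an extreme height. The column 0 in `U k 0` is a dummy, as `inner` at a `U` depends on the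
  -- height only.
  ∑ℕ-δ-pair : ∀ n k → k < suc (suc n) →
              ∑ℕ (suc n) (λ i → δ i k * 1 + δ (suc i) k * 1) ≡ 1 + inner (suc n) (U k 0)
  ∑ℕ-δ-pair n k k< = begin
    ∑ℕ (suc n) (λ i → δ i k * 1 + δ (suc i) k * 1)
      ≡⟨ ∑ℕ-cong (suc n) (λ i → cong₂ _+_ (ℕ.*-identityʳ (δ i k)) (ℕ.*-identityʳ (δ (suc i) k))) ⟩
    ∑ℕ (suc n) (λ i → δ i k + δ (suc i) k)
      ≡⟨ ∑ℕ-+ (suc n) (λ i → δ i k) (λ i → δ (suc i) k) ⟩
    ∑ℕ (suc n) (λ i → δ i k) + ∑ℕ (suc n) (λ i → δ (suc i) k)
      ≡⟨ cong (_+ ∑ℕ (suc n) (λ i → δ (suc i) k)) (∑ℕ-δ (suc n) k) ⟩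
    ⟦ k < suc n ⟧ + ∑ℕ (suc n) (λ i → δ (suc i) k)
      ≡⟨ split k k< ⟩
    1 + inner (suc n) (U k 0)
      ∎
    where
    open ≡-Reasoning
    split : ∀ k → k < suc (suc n) →
            ⟦ k < suc n ⟧ + ∑ℕ (suc n) (λ i → δ (suc i) k) ≡ 1 + inner (suc n) (U k 0)
    split zero    _        = cong suc (∑ℕ-0 n)
    split (suc k) (s≤s k<) = begin
      ⟦ k < n ⟧ + ∑ℕ (suc n) (λ i → δ i k)  ≡⟨ cong (⟦ k < n ⟧ +_) (∑ℕ-δ (suc n) k) ⟩
      ⟦ k < n ⟧ + ⟦ k < suc n ⟧             ≡⟨ cong (⟦ k < n ⟧ +_) (<⇒⟦<⟧≡1 k<) ⟩
      ⟦ k < n ⟧ + 1                         ≡⟨ ℕ.+-comm _ 1 ⟩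
      1 + ⟦ k < n ⟧                         ∎

  totalInc-++ : ∀ cs ds x → totalInc (cs ++ ds) x ≡ totalInc cs x + totalInc ds x
  totalInc-++ []             ds x = refl
  totalInc-++ ((i , j) ∷ cs) ds x =
    ≡.trans (cong (cellInc i j full x +_) (totalInc-++ cs ds x))
            (≡.sym (ℕ.+-assoc (cellInc i j full x) _ _))

  totalInc-concatUpTo : ∀ n f x → totalInc (concatUpTo n f) x ≡ ∑ℕ n (λ i → totalInc (f i) x)
  totalInc-concatUpTo zero    f x = refl
  totalInc-concatUpTo (suc n) f x =
    ≡.trans (totalInc-++ (f 0) _ x) (cong (totalInc (f 0) x +_) (totalInc-concatUpTo n (f ∘ suc) x))

  totalInc-cells : ∀ N x → totalInc (cells N) x ≡ ∑ℕ N λ i → ∑ℕ N λ j → cellInc i j full x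
  totalInc-cells N x =
    ≡.trans (totalInc-concatUpTo N _ x) (∑ℕ-cong N λ i →
    ≡.trans (totalInc-concatUpTo N (λ j → [ i , j ]) x) (∑ℕ-cong N λ j → ℕ.+-identityʳ _))

  -- An interior vertex lies in two cells and a boundary vertex in one. So the targets of the full
  -- diamond and of the inner one add up to the degrees of all cells filled, which makes
  -- complementation exchange them.
  totalInc-cells-balanced : ∀ n → Balanced (suc n) (𝟏 ⊕ inner (suc n)) (totalInc (cells (suc n)))
  totalInc-cells-balanced n (U k l) (k< , l<) = begin
    totalInc (cells N) (U k l)
      ≡⟨ totalInc-cells N (U k l) ⟩
    ∑ℕ N (λ i → ∑ℕ N λ j → (δ i k * 1 + δ (suc i) k * 1) * δ j l)
      ≡⟨ ∑ℕ-cong N (λ i → ≡.trans (∑ℕ-*ˡ N (δ i k * 1 + δ (suc i) k * 1) (λ j → δ j l))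
                                  (cong ((δ i k * 1 + δ (suc i) k * 1) *_) (∑ℕ-δ N l))) ⟩
    ∑ℕ N (λ i → (δ i k * 1 + δ (suc i) k * 1) * ⟦ l < N ⟧)
      ≡⟨ ∑ℕ-*ʳ N ⟦ l < N ⟧ (λ i → δ i k * 1 + δ (suc i) k * 1) ⟩
    ∑ℕ N (λ i → δ i k * 1 + δ (suc i) k * 1) * ⟦ l < N ⟧
      ≡⟨ cong₂ _*_ (∑ℕ-δ-pair n k k<) (<⇒⟦<⟧≡1 l<) ⟩
    (1 + inner N (U k 0)) * 1
      ≡⟨ ℕ.*-identityʳ _ ⟩
    1 + inner N (U k 0)
      ≡⟨ cong suc (irrelevant k) ⟩
    1 + inner N (U k l)
      ∎
    where
    open ≡-Reasoning
    N = suc n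
    irrelevant : ∀ k → inner N (U k 0) ≡ inner N (U k l)
    irrelevant zero    = refl
    irrelevant (suc k) = refl
  totalInc-cells-balanced n (V k l) (k< , l<) = begin
    totalInc (cells N) (V k l)
      ≡⟨ totalInc-cells N (V k l) ⟩
    ∑ℕ N (λ i → ∑ℕ N λ j → δ i k * (δ j l * 1 + δ (suc j) l * 1))
      ≡⟨ ∑ℕ-cong N (λ i → ∑ℕ-*ˡ N (δ i k) (λ j → δ j l * 1 + δ (suc j) l * 1)) ⟩
    ∑ℕ N (λ i → δ i k * ∑ℕ N (λ j → δ j l * 1 + δ (suc j) l * 1))
      ≡⟨ ∑ℕ-*ʳ N (∑ℕ N (λ j → δ j l * 1 + δ (suc j) l * 1)) (λ i → δ i k) ⟩
    ∑ℕ N (λ i → δ i k) * ∑ℕ N (λ j → δ j l * 1 + δ (suc j) l * 1)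
      ≡⟨ cong₂ _*_ (≡.trans (∑ℕ-δ N k) (<⇒⟦<⟧≡1 k<)) (∑ℕ-δ-pair n l l<) ⟩
    1 * (1 + inner N (U l 0))
      ≡⟨ ℕ.*-identityˡ _ ⟩
    1 + inner N (U l 0)
      ≡⟨ cong suc (transposed l) ⟩
    1 + inner N (V k l)
      ∎
    where
    open ≡-Reasoning
    N = suc n
    transposed : ∀ l → inner N (U l 0) ≡ inner N (V k l)
    transposed zero    = refl
    transposed (suc l) = refl

  -- Rows and then columns are taken in pairs. A permutation is needed because the two edge rows of
  -- a cell are not adjacent in row-major order.
  concatUpTo-blocks : ∀ N (f : ℕ → ℕ → A) →
    concatUpTo (N * 2) (λ r → concatUpTo (N * 2) (λ s → [ f r s ])) ↭
    concatUpTo N (λ i → concatUpTo N (λ j →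
      f (i * 2) (j * 2) ∷ f (i * 2) (suc (j * 2)) ∷
      f (suc (i * 2)) (j * 2) ∷ f (suc (i * 2)) (suc (j * 2)) ∷ []))
  concatUpTo-blocks {A = A} N f = begin
    concatUpTo (N * 2) row
      ≡⟨ concatUpTo-double N row ⟩
    concatUpTo N (λ i → row (i * 2) ++ row (suc (i * 2)))
      ≡⟨ concatUpTo-cong N (λ i → cong₂ _++_ (concatUpTo-double N λ s → [ f (i * 2) s ])
                                             (concatUpTo-double N λ s → [ f (suc (i * 2)) s ])) ⟩
    concatUpTo N (λ i → concatUpTo N (pair (i * 2)) ++ concatUpTo N (pair (suc (i * 2))))
      ↭⟨ concatUpTo-↭ N (λ i → ↭-sym (concatUpTo-++ N (pair (i * 2)) (pair (suc (i * 2))))) ⟩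
    concatUpTo N (λ i → concatUpTo N (λ j → pair (i * 2) j ++ pair (suc (i * 2)) j)) ∎
    where
    open PermutationReasoning
    row : ℕ → List A
    row r = concatUpTo (N * 2) λ s → [ f r s ]
    pair : ℕ → ℕ → List A
    pair r j = f r (j * 2) ∷ f r (suc (j * 2)) ∷ []

  edgeInc-U : ∀ r s → edgeInc r s (U ⌈ r /2⌉ ⌊ s /2⌋) ≡ 1
  edgeInc-U r s = cong₂ _*_ (δ-refl ⌈ r /2⌉) (δ-refl ⌊ s /2⌋)

  edgeInc-V : ∀ r s → edgeInc r s (V ⌊ r /2⌋ ⌈ s /2⌉) ≡ 1
  edgeInc-V r s = cong₂ _*_ (δ-refl ⌊ r /2⌋) (δ-refl ⌈ s /2⌉)

  -- Exchanges 2i and 2i + 1, so that λ r s → A (mirror r) (mirror s) is the array A with each cell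
  -- turned by 180°.
  mirror : ℕ → ℕ
  mirror 0             = 1
  mirror 1             = 0
  mirror (suc (suc n)) = suc (suc (mirror n))

  mirror-even : ∀ n → mirror (n * 2) ≡ suc (n * 2)
  mirror-even zero    = refl
  mirror-even (suc n) = cong (λ m → suc (suc m)) (mirror-even n)

  mirror-odd : ∀ n → mirror (suc (n * 2)) ≡ n * 2
  mirror-odd zero    = refl
  mirror-odd (suc n) = cong (λ m → suc (suc m)) (mirror-odd n)

-- Products of factors and their balanced coefficients

module AztecPartitionFunction {c ℓ : Level} (R : CommutativeRing c ℓ) where
  open CommutativeRing R hiding (zero)
  open Algebra.Properties.Semiring.Exp semiring
  open RingSolver commutativeSemiring using (solve; _:=_; _:+_; _:*_; con)
  import Relation.Binary.Reasoning.Setoid setoid as ≈-Reasoning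

  indicator : ∀ {p} {P : Set p} → Dec P → Carrier
  indicator P? = if does P? then 1# else 0#

  indicator-cong : ∀ {p q} {P : Set p} {Q : Set q} (P? : Dec P) (Q? : Dec Q) →
                   (P → Q) → (Q → P) → indicator P? ≈ indicator Q?
  indicator-cong (yes p) (yes q) to from = refl
  indicator-cong (yes p) (no ¬q) to from = contradiction (to p) ¬q
  indicator-cong (no ¬p) (yes q) to from = contradiction (from q) ¬p
  indicator-cong (no ¬p) (no ¬q) to from = refl

  indicator-no : ∀ {p} {P : Set p} (P? : Dec P) → ¬ P → indicator P? ≈ 0#
  indicator-no (yes p) ¬p = contradiction p ¬p
  indicator-no (no _)  ¬p = refl

  -- A factor stands for the polynomial ∑ w X^h over its terms (w , h).
  Factor : Set c
  Factor = List (Carrier × Degrees)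

  ∑ : Factor → (Degrees → Carrier) → Carrier
  ∑ []            F = 0#
  ∑ ((w , h) ∷ p) F = w * F h + ∑ p F

  ∑-cong : ∀ p {F G} → (∀ h → F h ≈ G h) → ∑ p F ≈ ∑ p G
  ∑-cong []            F≈G = refl
  ∑-cong ((w , h) ∷ p) F≈G = +-cong (*-congˡ (F≈G h)) (∑-cong p F≈G)

  ∑-zero : ∀ {p F} → All (λ (_ , h) → F h ≈ 0#) p → ∑ p F ≈ 0#
  ∑-zero []                        = refl
  ∑-zero {(w , h) ∷ _} (Fh≈0 ∷ p≈0) =
    trans (+-cong (trans (*-congˡ Fh≈0) (zeroʳ w)) (∑-zero p≈0)) (+-identityʳ 0#)

  ∑-linear : ∀ q w F G → ∑ q (λ h → w * F h + G h) ≈ w * ∑ q F + ∑ q G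
  ∑-linear []            w F G = sym (trans (+-identityʳ _) (zeroʳ w))
  ∑-linear ((s , h) ∷ q) w F G = trans (+-congˡ (∑-linear q w F G))
    (solve 6 (λ s w f g x y → s :* (w :* f :+ g) :+ (w :* x :+ y) :=
                              w :* (s :* f :+ x) :+ (s :* g :+ y))
           refl s w (F h) (G h) (∑ q F) (∑ q G))

  ∑-swap : ∀ p q (F : Degrees → Degrees → Carrier) →
           ∑ p (λ h → ∑ q (F h)) ≈ ∑ q (λ k → ∑ p (λ h → F h k))
  ∑-swap []            q F = sym (∑-zero (All.universal (λ _ → refl) q))
  ∑-swap ((w , h) ∷ p) q F =
    trans (+-congˡ (∑-swap p q F)) (sym (∑-linear q w (F h) (λ k → ∑ p (λ h → F h k))))

  module _ (N : ℕ) (t : Degrees) where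

    -- The sum of the coefficients of the X^h in the product of the factors for which g ⊕ h
    -- has the target degrees t on AD N.
    Z : List Factor → Degrees → Carrier
    Z []       g = indicator (balanced? N t g)
    Z (p ∷ fs) g = ∑ p (λ h → Z fs (g ⊕ h))

  Untouched : Vertex → List Factor → Set c
  Untouched x = All (All (λ (_ , h) → h x ≡ 0))

  edge : Carrier → Degrees → Factor
  edge w h = (1# , ∅) ∷ (w , h) ∷ []

  module _ {N : ℕ} {t : Degrees} where

    Z-cong : ∀ fs {g h} → g ≗ h → Z N t fs g ≈ Z N t fs h
    Z-cong [] {g} {h} g≗h = indicator-cong (balanced? N t g) (balanced? N t h)
                                         (λ bal x x∈ → ≡.trans (≡.sym (g≗h x)) (bal x x∈))
                                         (λ bal x x∈ → ≡.trans (g≗h x) (bal x x∈))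
    Z-cong (p ∷ fs) g≗h = ∑-cong p λ k → Z-cong fs λ x → cong (ℕ._+ k x) (g≗h x)

    -- For a transposition the two finite sums commute, and the accumulated degrees agree pointwise.
    Z-↭ : ∀ {fs gs} → fs ↭ gs → ∀ g → Z N t fs g ≈ Z N t gs g
    Z-↭ Perm.refl         g = refl
    Z-↭ (prep p σ)        g = ∑-cong p λ h → Z-↭ σ (g ⊕ h)
    Z-↭ {p ∷ q ∷ fs} {q ∷ p ∷ gs} (swap p q σ) g = begin
      ∑ p (λ h → ∑ q (λ k → Z N t fs (g ⊕ h ⊕ k)))
        ≈⟨ ∑-cong p (λ h → ∑-cong q λ k → trans (Z-↭ σ _) (Z-cong gs λ x → flip (g x) (h x) (k x))) ⟩
      ∑ p (λ h → ∑ q (λ k → Z N t gs (g ⊕ k ⊕ h)))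
        ≈⟨ ∑-swap p q _ ⟩
      ∑ q (λ k → ∑ p (λ h → Z N t gs (g ⊕ k ⊕ h))) ∎
      where
      open ≈-Reasoning
      flip : ∀ l m n → (l ℕ.+ m) ℕ.+ n ≡ (l ℕ.+ n) ℕ.+ m
      flip l m n = ≡.trans (ℕ.+-assoc l m n)
                           (≡.trans (cong (l ℕ.+_) (ℕ.+-comm m n)) (≡.sym (ℕ.+-assoc l n m)))
    Z-↭ (Perm.trans σ τ) g = trans (Z-↭ σ g) (Z-↭ τ g)

    -- Degrees only grow, so an excess at `x` survives until the final test.
    Z-overflow : ∀ x → x ∈AD N → ∀ fs {g} → t x < g x → Z N t fs g ≈ 0#
    Z-overflow x x∈ [] {g}   t<g = indicator-no (balanced? N t g) λ bal → ℕ.<⇒≢ t<g (≡.sym (bal x x∈))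
    Z-overflow x x∈ (p ∷ fs) t<g = ∑-zero (All.universal
      (λ (_ , h) → Z-overflow x x∈ fs (ℕ.≤-trans t<g (ℕ.m≤m+n _ (h x)))) p)

    -- No remaining factor changes the degree at `x`, so a wrong value there is final.
    Z-stuck : ∀ x → x ∈AD N → ∀ {fs} → Untouched x fs → ∀ {g} → g x ≢ t x → Z N t fs g ≈ 0#
    Z-stuck x x∈ [] {g}        g≢t = indicator-no (balanced? N t g) λ bal → g≢t (bal x x∈)
    Z-stuck x x∈ (p≡0 ∷ fs≡0) {g} g≢t = ∑-zero (All.map
      (λ h≡0 → Z-stuck x x∈ fs≡0 λ eq → g≢t (≡.trans (≡.sym (≡.trans (cong (g x ℕ.+_) h≡0)
                                                                     (ℕ.+-identityʳ (g x)))) eq)) p≡0)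

    Z-edge : ∀ w h fs g → Z N t (edge w h ∷ fs) g ≈ Z N t fs g + w * Z N t fs (g ⊕ h)
    Z-edge w h fs g = begin
      1# * Z N t fs (g ⊕ ∅) + (w * Z N t fs (g ⊕ h) + 0#)
        ≈⟨ +-cong (*-identityˡ _) (+-identityʳ _) ⟩
      Z N t fs (g ⊕ ∅) + w * Z N t fs (g ⊕ h)
        ≈⟨ +-congʳ (Z-cong fs λ x → ℕ.+-identityʳ (g x)) ⟩
      Z N t fs g + w * Z N t fs (g ⊕ h) ∎
      where open ≈-Reasoning

    -- Congruence of products of factors: both sides may be completed by any further factors.
    record _≋_ (fs gs : List Factor) : Set (c Level.⊔ ℓ) where
      constructor mk≋
      field completed : ∀ hs g → Z N t (fs ++ hs) g ≈ Z N t (gs ++ hs) g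
    open _≋_

    ≋-Z : ∀ {fs gs} → fs ≋ gs → ∀ g → Z N t fs g ≈ Z N t gs g
    ≋-Z {fs} {gs} eq g = ≡.subst₂ (λ fs gs → Z N t fs g ≈ Z N t gs g)
      (List.++-identityʳ fs) (List.++-identityʳ gs) (completed eq [] g)

    ≋-refl : ∀ {fs} → fs ≋ fs
    ≋-refl = mk≋ λ hs g → refl

    ≋-trans : ∀ {fs gs ks} → fs ≋ gs → gs ≋ ks → fs ≋ ks
    ≋-trans p q = mk≋ λ hs g → trans (completed p hs g) (completed q hs g)

    ≋-++ : ∀ {fs fs′ gs gs′} → fs ≋ fs′ → gs ≋ gs′ → (fs ++ gs) ≋ (fs′ ++ gs′)
    ≋-++ {fs} {fs′} {gs} {gs′} p q = mk≋ λ hs g → begin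
      Z N t ((fs ++ gs) ++ hs) g    ≡⟨ cong (λ ks → Z N t ks g) (List.++-assoc fs gs hs) ⟩
      Z N t (fs ++ (gs ++ hs)) g    ≈⟨ prefix fs hs g ⟩
      Z N t (fs ++ (gs′ ++ hs)) g   ≈⟨ completed p (gs′ ++ hs) g ⟩
      Z N t (fs′ ++ (gs′ ++ hs)) g  ≡⟨ cong (λ ks → Z N t ks g) (List.++-assoc fs′ gs′ hs) ⟨
      Z N t ((fs′ ++ gs′) ++ hs) g  ∎
      where
      open ≈-Reasoning
      prefix : ∀ ks hs g → Z N t (ks ++ (gs ++ hs)) g ≈ Z N t (ks ++ (gs′ ++ hs)) g
      prefix []       hs g = completed q hs g
      prefix (p ∷ ks) hs g = ∑-cong p λ h → prefix ks hs (g ⊕ h)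

    ≋-concatUpTo : ∀ n {f f′ : ℕ → List Factor} →
                   (∀ {i} → i < n → f i ≋ f′ i) → concatUpTo n f ≋ concatUpTo n f′
    ≋-concatUpTo zero    eq = ≋-refl
    ≋-concatUpTo (suc n) eq = ≋-++ (eq (s≤s z≤n)) (≋-concatUpTo n (λ i<n → eq (s≤s i<n)))

    edge-cong : ∀ {w h k} → h ≗ k → [ edge w h ] ≋ [ edge w k ]
    edge-cong {w} {h} {k} h≗k = mk≋ λ fs g →
      +-congˡ (+-congʳ (*-congˡ (Z-cong fs λ x → cong (g x ℕ.+_) (h≗k x))))

    -- Choosing the edge would exceed the target at `x`, so only the term 1 of its factor
    -- contributes.
    edge-drop : ∀ {w h} x → x ∈AD N → t x < h x → [ edge w h ] ≋ []
    edge-drop {w} {h} x x∈ t<h = mk≋ λ fs g → begin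
      Z N t (edge w h ∷ fs) g            ≈⟨ Z-edge w h fs g ⟩
      Z N t fs g + w * Z N t fs (g ⊕ h)  ≈⟨ +-congˡ (*-congˡ (Z-overflow x x∈ fs
                                              (ℕ.≤-trans t<h (ℕ.m≤n+m (h x) (g x))))) ⟩
      Z N t fs g + w * 0#                ≈⟨ +-congˡ (zeroʳ w) ⟩
      Z N t fs g + 0#                    ≈⟨ +-identityʳ _ ⟩
      Z N t fs g                         ∎
      where open ≈-Reasoning

  -- A cell is covered completely by either of its two pairs of opposite edges.
  cellWeight : (ℕ → ℕ → Carrier) → ℕ → ℕ → State → Carrier
  cellWeight A i j none = 1#
  cellWeight A i j nw   = A (i ℕ.* 2) (j ℕ.* 2)
  cellWeight A i j ne   = A (i ℕ.* 2) (suc (j ℕ.* 2))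
  cellWeight A i j sw   = A (suc (i ℕ.* 2)) (j ℕ.* 2)
  cellWeight A i j se   = A (suc (i ℕ.* 2)) (suc (j ℕ.* 2))
  cellWeight A i j full = cellWeight A i j nw * cellWeight A i j se +
                          cellWeight A i j ne * cellWeight A i j sw

  cell : (State → Carrier) → (State → Degrees) → Factor
  cell w h = map (λ T → w T , h T) states

  module _ {N : ℕ} {t : Degrees} where

    Z-overlap : ∀ x → x ∈AD N → t x ≤ 1 → ∀ {h k} → h x ≡ 1 → k x ≡ 1 →
                ∀ fs g → Z N t fs (g ⊕ h ⊕ k) ≈ 0#
    Z-overlap x x∈ t≤1 {h} {k} hx kx fs g = Z-overflow x x∈ fs
      (ℕ.≤-trans (s≤s t≤1) (ℕ.≤-trans (ℕ.m≤n+m 2 (g x)) (ℕ.≤-reflexive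
        (≡.trans (≡.sym (cong (g x ℕ.+_) (cong₂ ℕ._+_ hx kx))) (≡.sym (ℕ.+-assoc (g x) (h x) (k x)))))))

    -- The two edges share the vertex `x`, so the cross term of the product covers it twice and
    -- vanishes.
    Z-fork : ∀ x → x ∈AD N → t x ≤ 1 → ∀ {h k} → h x ≡ 1 → k x ≡ 1 → ∀ w y fs g →
             Z N t (edge w h ∷ edge y k ∷ fs) g ≈
             Z N t fs g + w * Z N t fs (g ⊕ h) + y * Z N t fs (g ⊕ k)
    Z-fork x x∈ t≤1 {h} {k} hx kx w y fs g = begin
      Z N t (edge w h ∷ edge y k ∷ fs) g
        ≈⟨ Z-edge w h (edge y k ∷ fs) g ⟩
      Z N t (edge y k ∷ fs) g + w * Z N t (edge y k ∷ fs) (g ⊕ h)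
        ≈⟨ +-cong (Z-edge y k fs g) (*-congˡ (Z-edge y k fs (g ⊕ h))) ⟩
      (Z N t fs g + y * Z N t fs (g ⊕ k)) + w * (Z N t fs (g ⊕ h) + y * Z N t fs (g ⊕ h ⊕ k))
        ≈⟨ +-congˡ (*-congˡ (+-congˡ (*-congˡ (Z-overlap x x∈ t≤1 hx kx fs g)))) ⟩
      (Z N t fs g + y * Z N t fs (g ⊕ k)) + w * (Z N t fs (g ⊕ h) + y * 0#)
        ≈⟨ solve 5 (λ a b c w y → (a :+ y :* b) :+ w :* (c :+ y :* con 0) := a :+ w :* c :+ y :* b)
             refl (Z N t fs g) (Z N t fs (g ⊕ k)) (Z N t fs (g ⊕ h)) w y ⟩
      Z N t fs g + w * Z N t fs (g ⊕ h) + y * Z N t fs (g ⊕ k) ∎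
      where open ≈-Reasoning

    -- Of the sixteen sets of edges of a cell, those with two edges at a common vertex vanish. The
    -- empty set, the four single edges and the two opposite pairs remain; both pairs cover the
    -- whole cell and merge into `full`.
    edges≋cell : (∀ x → t x ≤ 1) → ∀ {i j} → i < N → j < N → ∀ A →
      let w = cellWeight A i j ; h = cellInc i j in
      (edge (w nw) (h nw) ∷ edge (w ne) (h ne) ∷ edge (w sw) (h sw) ∷ edge (w se) (h se) ∷ [])
        ≋ [ cell w h ]
    edges≋cell t≤1 {i} {j} i<N j<N A = mk≋ λ fs g → begin
      Z N t (edge (w nw) (h nw) ∷ edge (w ne) (h ne) ∷ south fs) g
        -- The north edges meet at the top vertex. After this the south edges are split at the
        -- bottom vertex, and `nw` with `sw` and `ne` with `se` are excluded at the left and right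
        -- vertices.
        ≈⟨ Z-fork (U i j) (ℕ.m<n⇒m<1+n i<N , j<N) (t≤1 _) (cellInc-top i j nw) (cellInc-top i j ne)
                  (w nw) (w ne) (south fs) g ⟩
      Z N t (south fs) g + w nw * Z N t (south fs) (g ⊕ h nw) + w ne * Z N t (south fs) (g ⊕ h ne)
        ≈⟨ +-cong (+-cong (Z-south fs g) (*-congˡ (north-west fs g))) (*-congˡ (north-east fs g)) ⟩
      z fs g + w sw * z fs (g ⊕ h sw) + w se * z fs (g ⊕ h se)
        + w nw * (z fs (g ⊕ h nw) + w se * z fs (g ⊕ h full))
        + w ne * (z fs (g ⊕ h ne) + w sw * z fs (g ⊕ h full))
        ≈⟨ solve 10 (λ zø znw zne zsw zse zf nw ne sw se →
             zø :+ sw :* zsw :+ se :* zse :+ nw :* (znw :+ se :* zf) :+ ne :* (zne :+ sw :* zf)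
             := con 1 :* zø :+ (nw :* znw :+ (ne :* zne :+ (sw :* zsw :+ (se :* zse :+
                ((nw :* se :+ ne :* sw) :* zf :+ con 0))))))
             refl (z fs g) (z fs (g ⊕ h nw)) (z fs (g ⊕ h ne)) (z fs (g ⊕ h sw)) (z fs (g ⊕ h se))
             (z fs (g ⊕ h full)) (w nw) (w ne) (w sw) (w se) ⟩
      1# * z fs g + (w nw * z fs (g ⊕ h nw) + (w ne * z fs (g ⊕ h ne) + (w sw * z fs (g ⊕ h sw) +
        (w se * z fs (g ⊕ h se) + (w full * z fs (g ⊕ h full) + 0#)))))
        ≈⟨ +-congʳ (*-congˡ (Z-cong fs λ x → ≡.trans (≡.sym (ℕ.+-identityʳ (g x)))
                                                     (cong (g x ℕ.+_) (≡.sym (h-none x))))) ⟩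
      Z N t (cell w h ∷ fs) g ∎
      where
      open ≈-Reasoning
      w = cellWeight A i j
      h = cellInc i j
      z = Z N t
      south : List Factor → List Factor
      south fs = edge (w sw) (h sw) ∷ edge (w se) (h se) ∷ fs
      h-none : h none ≗ ∅
      h-none (U k l) = cong (ℕ._* δ j l) (cong₂ ℕ._+_ (ℕ.*-zeroʳ (δ i k)) (ℕ.*-zeroʳ (δ (suc i) k)))
      h-none (V k l) = ≡.trans
        (cong (δ i k ℕ.*_) (cong₂ ℕ._+_ (ℕ.*-zeroʳ (δ j l)) (ℕ.*-zeroʳ (δ (suc j) l))))
        (ℕ.*-zeroʳ (δ i k))
      Z-south : ∀ fs g → z (south fs) g ≈ z fs g + w sw * z fs (g ⊕ h sw) + w se * z fs (g ⊕ h se)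
      Z-south = Z-fork (U (suc i) j) (s≤s i<N , j<N) (t≤1 _)
                       (cellInc-bottom i j sw) (cellInc-bottom i j se) (w sw) (w se)
      merge : ∀ {S T} → S ⊎ T ≐ full → ∀ fs g → z fs (g ⊕ h S ⊕ h T) ≈ z fs (g ⊕ h full)
      merge {S} {T} S⊎T fs g = Z-cong fs λ x →
        ≡.trans (ℕ.+-assoc (g x) (h S x) (h T x)) (cong (g x ℕ.+_) (cellInc-⊎ S⊎T i j x))
      north-west : ∀ fs g → z (south fs) (g ⊕ h nw) ≈ z fs (g ⊕ h nw) + w se * z fs (g ⊕ h full)
      north-west fs g = begin
        z (south fs) (g ⊕ h nw)
          ≈⟨ Z-south fs (g ⊕ h nw) ⟩
        z fs (g ⊕ h nw) + w sw * z fs (g ⊕ h nw ⊕ h sw) + w se * z fs (g ⊕ h nw ⊕ h se)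
          ≈⟨ +-cong (+-congˡ (*-congˡ (Z-overlap (V i j) (i<N , ℕ.m<n⇒m<1+n j<N) (t≤1 _)
                               (cellInc-left i j nw) (cellInc-left i j sw) fs g)))
                    (*-congˡ (merge disjoint fs g)) ⟩
        z fs (g ⊕ h nw) + w sw * 0# + w se * z fs (g ⊕ h full)
          ≈⟨ +-congʳ (trans (+-congˡ (zeroʳ (w sw))) (+-identityʳ _)) ⟩
        z fs (g ⊕ h nw) + w se * z fs (g ⊕ h full) ∎
      north-east : ∀ fs g → z (south fs) (g ⊕ h ne) ≈ z fs (g ⊕ h ne) + w sw * z fs (g ⊕ h full)
      north-east fs g = begin
        z (south fs) (g ⊕ h ne)
          ≈⟨ Z-south fs (g ⊕ h ne) ⟩
        z fs (g ⊕ h ne) + w sw * z fs (g ⊕ h ne ⊕ h sw) + w se * z fs (g ⊕ h ne ⊕ h se)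
          ≈⟨ +-cong (+-congˡ (*-congˡ (merge disjoint fs g)))
                    (*-congˡ (Z-overlap (V i (suc j)) (i<N , s≤s j<N) (t≤1 _)
                               (cellInc-right i j ne) (cellInc-right i j se) fs g)) ⟩
        z fs (g ⊕ h ne) + w sw * z fs (g ⊕ h full) + w se * 0#
          ≈⟨ trans (+-congˡ (zeroʳ (w se))) (+-identityʳ _) ⟩
        z fs (g ⊕ h ne) + w sw * z fs (g ⊕ h full) ∎

  -- Arrays of edges and of cells

  edgeArray : ℕ → (ℕ → ℕ → Carrier) → List Factor
  edgeArray N A = concatUpTo (N ℕ.* 2) λ r → concatUpTo (N ℕ.* 2) λ s →
    [ edge (A r s) (edgeInc r s) ]

  innerEdgeArray : ℕ → (ℕ → ℕ → Carrier) → List Factor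
  innerEdgeArray N A = concatUpTo (N ℕ.* 2) λ r → concatUpTo (N ℕ.* 2) λ s →
    [ edge (A (suc r) (suc s)) (edgeInc (suc r) (suc s)) ]

  cellArray : ℕ → (ℕ → ℕ → State → Carrier) → List Factor
  cellArray N w = concatUpTo N λ i → concatUpTo N λ j → [ cell (w i j) (cellInc i j) ]

  Z-edgeArray : ∀ N t → (∀ x → t x ≤ 1) → ∀ A g →
                Z N t (edgeArray N A) g ≈ Z N t (cellArray N (cellWeight A)) g
  Z-edgeArray N t t≤1 A g = trans
    (Z-↭ (concatUpTo-blocks N λ r s → edge (A r s) (edgeInc r s)) g)
    (≋-Z (≋-concatUpTo N λ {i} i<N → ≋-concatUpTo N λ {j} j<N → ≋-trans
      (≋-++ (edge-cong (edgeInc-nw i j)) (≋-++ (edge-cong (edgeInc-ne i j))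
        (≋-++ (edge-cong (edgeInc-sw i j)) (edge-cong (edgeInc-se i j)))))
      (edges≋cell t≤1 i<N j<N A)) g)

  module _ {N : ℕ} {t : Degrees} where

    concatUpTo-dropped : ∀ n {f : ℕ → List Factor} → (∀ {i} → i < n → _≋_ {N} {t} (f i) []) →
                         _≋_ {N} {t} (concatUpTo n f) []
    concatUpTo-dropped n {f} f≋[] = ≡.subst (λ fs → _≋_ {N} {t} (concatUpTo n f) fs)
      (concatUpTo-[] n) (≋-concatUpTo n f≋[])

    concatUpTo-trim : ∀ n (f f′ : ℕ → List Factor) →
                      _≋_ {N} {t} (f 0) [] → _≋_ {N} {t} (f (suc n)) [] →
                      (∀ {i} → i < n → _≋_ {N} {t} (f (suc i)) (f′ i)) →
                      _≋_ {N} {t} (concatUpTo (2 ℕ.+ n) f) (concatUpTo n f′)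
    concatUpTo-trim n f f′ first last middle = ≋-++ first
      (≡.subst₂ (_≋_ {N} {t}) (≡.sym (concatUpTo-last n (f ∘ suc)))
                                 (List.++-identityʳ (concatUpTo n f′))
        (≋-++ (≋-concatUpTo n middle) last))

  -- Every edge of the outer ring of the array ends at a boundary vertex of `AD (suc N)`, where the
  -- target is 0. The first and last rows fail at a `U`, the first and last columns at a `V`.
  Z-innerEdgeArray : ∀ N A g → Z (suc N) (inner (suc N)) (edgeArray (suc N) A) g ≈
                               Z (suc N) (inner (suc N)) (innerEdgeArray N A) g
  Z-innerEdgeArray N A = ≋-Z (concatUpTo-trim (N ℕ.* 2)
    (λ r → concatUpTo (suc N ℕ.* 2) λ s → [ factor r s ])
    (λ r → concatUpTo (N ℕ.* 2) λ s → [ factor (suc r) (suc s) ])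
    (concatUpTo-dropped (suc N ℕ.* 2) λ {s} s< →
      dropU 0 s (s≤s z≤n) (⌊/2⌋-< s<) ≡.refl)
    (concatUpTo-dropped (suc N ℕ.* 2) λ {s} s< →
      dropU (suc (N ℕ.* 2)) s (s≤s (s≤s (ℕ.≤-reflexive (⌊m*2/2⌋≡m N)))) (⌊/2⌋-< s<)
            (≡.trans (cong ⟦_< N ⟧ (⌊m*2/2⌋≡m N)) (⟦n<n⟧≡0 N)))
    (λ {r} r< → concatUpTo-trim (N ℕ.* 2)
      (λ s → [ factor (suc r) s ]) (λ s → [ factor (suc r) (suc s) ])
      (dropV (suc r) 0 (row< r<) (s≤s z≤n) ≡.refl)
      (dropV (suc r) (suc (N ℕ.* 2)) (row< r<) (s≤s (s≤s (ℕ.≤-reflexive (⌊m*2/2⌋≡m N))))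
             (≡.trans (cong ⟦_< N ⟧ (⌊m*2/2⌋≡m N)) (⟦n<n⟧≡0 N)))
      (λ _ → ≋-refl)))
    where
    factor : ℕ → ℕ → Factor
    factor r s = edge (A r s) (edgeInc r s)
    row< : ∀ {r} → r < N ℕ.* 2 → ⌊ suc r /2⌋ < suc N
    row< r< = ⌊/2⌋-< (s≤s (ℕ.m<n⇒m<1+n r<))
    boundary : ∀ {m n} → m ≡ 0 → n ≡ 1 → m < n
    boundary ≡.refl ≡.refl = s≤s z≤n
    dropU : ∀ r s → ⌈ r /2⌉ < suc (suc N) → ⌊ s /2⌋ < suc N →
            inner (suc N) (U ⌈ r /2⌉ ⌊ s /2⌋) ≡ 0 →
            _≋_ {suc N} {inner (suc N)} [ factor r s ] []
    dropU r s r< s< t≡0 = edge-drop (U ⌈ r /2⌉ ⌊ s /2⌋) (r< , s<) (boundary t≡0 (edgeInc-U r s))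
    dropV : ∀ r s → ⌊ r /2⌋ < suc N → ⌈ s /2⌉ < suc (suc N) →
            inner (suc N) (V ⌊ r /2⌋ ⌈ s /2⌉) ≡ 0 →
            _≋_ {suc N} {inner (suc N)} [ factor r s ] []
    dropV r s r< s< t≡0 = edge-drop (V ⌊ r /2⌋ ⌈ s /2⌉) (r< , s<) (boundary t≡0 (edgeInc-V r s))

  -- Matchings as terms of the product of the edge factors

  sumOver : ∀ {x} {X : Set x} → List X → (X → Carrier) → Carrier
  sumOver xs f = foldr _+_ 0# (map f xs)

  sumOver-cong : ∀ {x} {X : Set x} (xs : List X) {f f′} → (∀ y → f y ≈ f′ y) →
                 sumOver xs f ≈ sumOver xs f′
  sumOver-cong []       f≈f′ = refl
  sumOver-cong (x ∷ xs) f≈f′ = +-cong (f≈f′ x) (sumOver-cong xs f≈f′)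

  sumOver-*ˡ : ∀ {x} {X : Set x} (xs : List X) w f → sumOver xs (λ y → w * f y) ≈ w * sumOver xs f
  sumOver-*ˡ []       w f = sym (zeroʳ w)
  sumOver-*ˡ (x ∷ xs) w f = trans (+-congˡ (sumOver-*ˡ xs w f)) (sym (distribˡ w (f x) _))

  sumOver-map-++ : ∀ {x y} {X : Set x} {Y : Set y} (h : X → Y) xs ys f →
                   sumOver (map h xs ++ ys) f ≈ sumOver xs (f ∘ h) + sumOver ys f
  sumOver-map-++ h []       ys f = sym (+-identityˡ _)
  sumOver-map-++ h (x ∷ xs) ys f = trans (+-congˡ (sumOver-map-++ h xs ys f)) (sym (+-assoc _ _ _))

  sumOver-filter : ∀ {x p} {X : Set x} {P : X → Set p} (P? : ∀ y → Dec (P y)) xs f →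
                   sumOver (filter P? xs) f ≈ sumOver xs (λ y → indicator (P? y) * f y)
  sumOver-filter P? []       f = refl
  sumOver-filter P? (x ∷ xs) f with does (P? x)
  ... | true  = +-cong (sym (*-identityˡ _)) (sumOver-filter P? xs f)
  ... | false = trans (sumOver-filter P? xs f) (sym (trans (+-congʳ (zeroˡ _)) (+-identityˡ _)))

  -- Expanding the product of the factors 1 + w X^h gives one term per sublist. The initial degrees
  -- `g` are general so that the induction can absorb a chosen edge.
  Z-sublists : ∀ {N t} {E : Set} (wt : E → Carrier) (inc : E → Degrees) es g →
    sumOver (sublists es) (λ S → indicator (balanced? N t (g ⊕ degrees inc S)) * matchingWeight R wt S)
    ≈ Z N t (map (λ e → edge (wt e) (inc e)) es) g
  Z-sublists {N} {t} wt inc [] g =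
    trans (+-identityʳ _) (trans (*-identityʳ _) (Z-cong {N} {t} [] λ x → ℕ.+-identityʳ (g x)))
  Z-sublists {N} {t} wt inc (e ∷ es) g = begin
    sumOver (map (e ∷_) (sublists es) ++ sublists es) (term g)
      ≈⟨ sumOver-map-++ (e ∷_) (sublists es) _ (term g) ⟩
    sumOver (sublists es) (term g ∘ (e ∷_)) + sumOver (sublists es) (term g)
      -- `sublists` puts the lists containing `e` first, while `edge` puts the term without it
      -- first.
      ≈⟨ +-comm _ _ ⟩
    sumOver (sublists es) (term g) + sumOver (sublists es) (term g ∘ (e ∷_))
      ≈⟨ +-congˡ (sumOver-cong (sublists es) split) ⟩
    sumOver (sublists es) (term g) + sumOver (sublists es) (λ S → wt e * term (g ⊕ inc e) S)
      ≈⟨ +-cong (Z-sublists wt inc es g)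
                (trans (sumOver-*ˡ (sublists es) (wt e) _) (*-congˡ (Z-sublists wt inc es _))) ⟩
    Z N t fs g + wt e * Z N t fs (g ⊕ inc e)
      ≈⟨ Z-edge (wt e) (inc e) fs g ⟨
    Z N t (edge (wt e) (inc e) ∷ fs) g ∎
    where
    open ≈-Reasoning
    fs = map (λ e → edge (wt e) (inc e)) es
    term : Degrees → List _ → Carrier
    term g S = indicator (balanced? N t (g ⊕ degrees inc S)) * matchingWeight R wt S
    split : ∀ S → term g (e ∷ S) ≈ wt e * term (g ⊕ inc e) S
    split S = begin
      indicator (balanced? N t (g ⊕ degrees inc (e ∷ S))) * (wt e * matchingWeight R wt S)
        ≈⟨ *-congʳ (Z-cong {N} {t} [] {g ⊕ degrees inc (e ∷ S)} {g ⊕ inc e ⊕ degrees inc S}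
                          λ x → ≡.sym (ℕ.+-assoc (g x) (inc e x) _)) ⟩
      indicator (balanced? N t (g ⊕ inc e ⊕ degrees inc S)) * (wt e * matchingWeight R wt S)
        ≈⟨ solve 3 (λ i w m → i :* (w :* m) := w :* (i :* m)) refl _ (wt e) _ ⟩
      wt e * term (g ⊕ inc e) S ∎

  -- The degree map and the target are left open, so that it serves both for `AD N` itself and for
  -- its copy inside `AD (suc N)`.
  M≈Z : ∀ {N N′ t} (inc : AztecEdge N → Degrees) (wt : AztecEdge N → Carrier) →
        (∀ S → FiniteGraph.IsPerfectMatching (AD N) S → Balanced N′ t (degrees inc S)) →
        (∀ S → Balanced N′ t (degrees inc S) → FiniteGraph.IsPerfectMatching (AD N) S) →
        M R (AD N) wt ≈ Z N′ t (map (λ e → edge (wt e) (inc e)) (FiniteGraph.edges (AD N))) ∅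
  M≈Z {N} {N′} {t} inc wt to from = begin
    M R (AD N) wt
      ≈⟨ sumOver-filter pm? (sublists es) (matchingWeight R wt) ⟩
    sumOver (sublists es) (λ S → indicator (pm? S) * matchingWeight R wt S)
      ≈⟨ sumOver-cong (sublists es) (λ S →
           *-congʳ (indicator-cong (pm? S) (balanced? N′ t (degrees inc S)) (to S) (from S))) ⟩
    sumOver (sublists es) (λ S → indicator (balanced? N′ t (degrees inc S)) * matchingWeight R wt S)
      ≈⟨ Z-sublists wt inc es ∅ ⟩
    Z N′ t (map (λ e → edge (wt e) (inc e)) es) ∅ ∎
    where
    open ≈-Reasoning
    es = FiniteGraph.edges (AD N)
    pm? = FiniteGraph.isPerfectMatching? (AD N)

  aztecM : ℕ → (ℕ → ℕ → Carrier) → Carrier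
  aztecM N A = M R (AD N) λ (r , s) → A (toℕ r) (toℕ s)

  aztecM≈Z : ∀ N A → aztecM N A ≈ Z N 𝟏 (cellArray N (cellWeight A)) ∅
  aztecM≈Z N A = begin
    aztecM N A
      ≈⟨ M≈Z {N} aztecInc _ matching⇒balanced balanced⇒matching ⟩
    Z N 𝟏 (map (λ (r , s) → edge (A (toℕ r) (toℕ s)) (edgeInc (toℕ r) (toℕ s)))
               (cartesianProduct (allFin (N ℕ.* 2)) (allFin (N ℕ.* 2)))) ∅
      ≡⟨ cong (λ fs → Z N 𝟏 fs ∅) (map-allFin² (N ℕ.* 2) λ r s → edge (A r s) (edgeInc r s)) ⟩
    Z N 𝟏 (edgeArray N A) ∅
      ≈⟨ Z-edgeArray N 𝟏 (λ _ → ℕ.≤-refl) A ∅ ⟩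
    Z N 𝟏 (cellArray N (cellWeight A)) ∅ ∎
    where open ≈-Reasoning

  -- The outer ring of edges can be restored at no cost, since the target `inner` excludes it. This
  -- expresses the smaller diamond by the same cells as the larger one.
  aztecM-inner≈Z : ∀ N A → aztecM N (λ r s → A (suc r) (suc s)) ≈
                   Z (suc N) (inner (suc N)) (cellArray (suc N) (cellWeight A)) ∅
  aztecM-inner≈Z N A = begin
    aztecM N (λ r s → A (suc r) (suc s))
      ≈⟨ M≈Z {N} innerInc _ (λ S pm → aztecBalanced⇒innerBalanced S (matching⇒balanced S pm))
                         (λ S bal → balanced⇒matching S (innerBalanced⇒aztecBalanced S bal)) ⟩
    z (map (λ (r , s) → edge (A (suc (toℕ r)) (suc (toℕ s))) (edgeInc (suc (toℕ r)) (suc (toℕ s))))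
           (cartesianProduct (allFin (N ℕ.* 2)) (allFin (N ℕ.* 2)))) ∅
      ≡⟨ cong (λ fs → z fs ∅)
           (map-allFin² (N ℕ.* 2) λ r s → edge (A (suc r) (suc s)) (edgeInc (suc r) (suc s))) ⟩
    z (innerEdgeArray N A) ∅
      ≈⟨ Z-innerEdgeArray N A ∅ ⟨
    z (edgeArray (suc N) A) ∅
      ≈⟨ Z-edgeArray (suc N) (inner (suc N)) (inner≤1 (suc N)) A ∅ ⟩
    z (cellArray (suc N) (cellWeight A)) ∅ ∎
    where
    open ≈-Reasoning
    z = Z (suc N) (inner (suc N))

  -- Complementation

  -- Each state on one side is paired with its complement on the other. The degrees reached on both
  -- sides and those of the cells still to come always add up to `t ⊕ t′`, so at the end one side
  -- meets its target exactly when the other does.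
  Z-complement : ∀ {N t t′} (w : ℕ → ℕ → State → Carrier) cs g g′ →
    Balanced N (t ⊕ t′) (g ⊕ g′ ⊕ totalInc cs) →
    Z N t  (map (λ (i , j) → cell (w i j ∘ co) (cellInc i j)) cs) g ≈
    Z N t′ (map (λ (i , j) → cell (w i j) (cellInc i j)) cs) g′
  Z-complement {N} {t} {t′} w [] g g′ bal =
    indicator-cong (balanced? N t g) (balanced? N t′ g′)
      (λ g≡t x x∈ → ℕ.+-cancelˡ-≡ (t x) _ _
        (≡.trans (cong (ℕ._+ g′ x) (≡.sym (g≡t x x∈))) (total x x∈)))
      (λ g′≡t′ x x∈ → ℕ.+-cancelʳ-≡ (t′ x) _ _
        (≡.trans (cong (g x ℕ.+_) (≡.sym (g′≡t′ x x∈))) (total x x∈)))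
    where
    total : ∀ x → x ∈AD N → g x ℕ.+ g′ x ≡ t x ℕ.+ t′ x
    total x x∈ = ≡.trans (≡.sym (ℕ.+-identityʳ _)) (bal x x∈)
  Z-complement {N} {t} {t′} w ((i , j) ∷ cs) g g′ bal =
    trans (+-cong (step none) (+-cong (step nw) (+-cong (step ne) (+-cong (step sw) (+-cong (step se)
            (+-congʳ (step full)))))))
          -- `co` reverses the order of `states`, so the six terms appear backwards.
          (solve 6 (λ a b c d e f → f :+ (e :+ (d :+ (c :+ (b :+ (a :+ con 0))))) :=
                                    a :+ (b :+ (c :+ (d :+ (e :+ (f :+ con 0)))))) refl
            (term none) (term nw) (term ne) (term sw) (term se) (term full))
    where
    h = cellInc i j
    term : State → Carrier
    term T = w i j T * Z N t′ (map (λ (i , j) → cell (w i j) (cellInc i j)) cs) (g′ ⊕ h T)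
    step : ∀ T → w i j (co T) * Z N t (map (λ (i , j) → cell (w i j ∘ co) (cellInc i j)) cs) (g ⊕ h T) ≈
                 term (co T)
    step T = *-congˡ (Z-complement w cs (g ⊕ h T) (g′ ⊕ h (co T)) λ x x∈ → ≡.trans
      (≡.trans (rearrange (g x) (h T x) (g′ x) (h (co T) x) (totalInc cs x))
               (cong (λ m → (g x ℕ.+ g′ x) ℕ.+ (m ℕ.+ totalInc cs x)) (cellInc-⊎ (T⊎coT T) i j x)))
      (bal x x∈))
      where
      open Data.Nat.Solver.+-*-Solver renaming (solve to ℕ-solve; _:+_ to _⊞_; _:=_ to _⩵_)
      rearrange : ∀ a b c d e → ((a ℕ.+ b) ℕ.+ (c ℕ.+ d)) ℕ.+ e ≡ (a ℕ.+ c) ℕ.+ ((b ℕ.+ d) ℕ.+ e)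
      rearrange = ℕ-solve 5 (λ a b c d e → ((a ⊞ b) ⊞ (c ⊞ d)) ⊞ e ⩵ (a ⊞ c) ⊞ ((b ⊞ d) ⊞ e)) ≡.refl

  map-cells : ∀ {a} {X : Set a} (f : ℕ → ℕ → X) N →
              map (uncurry f) (cells N) ≡ concatUpTo N (λ i → concatUpTo N λ j → [ f i j ])
  map-cells f N = ≡.trans (map-concatUpTo (uncurry f) N _)
                          (concatUpTo-cong N λ i → map-concatUpTo (uncurry f) N _)

  Z-cellArray-complement : ∀ n (w : ℕ → ℕ → State → Carrier) →
    Z (suc n) 𝟏 (cellArray (suc n) (λ i j → w i j ∘ co)) ∅ ≈
    Z (suc n) (inner (suc n)) (cellArray (suc n) w) ∅
  Z-cellArray-complement n w = ≡.subst₂ (λ fs gs → Z N 𝟏 fs ∅ ≈ Z N (inner N) gs ∅)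
    (map-cells (λ i j → cell (w i j ∘ co) (cellInc i j)) N)
    (map-cells (λ i j → cell (w i j) (cellInc i j)) N)
    (Z-complement w (cells N) ∅ ∅ (totalInc-cells-balanced n))
    where N = suc n

  -- Gauge transformations along the lines of cells

  ∏ : ℕ → (ℕ → Carrier) → Carrier
  ∏ zero    f = 1#
  ∏ (suc n) f = f 0 * ∏ n (f ∘ suc)

  line : ℕ → (ℕ → State → Carrier) → (ℕ → State → Degrees) → List Factor
  line n z inc = concatUpTo n λ k → [ cell (z k) (inc k) ]

  ∑-scale : ∀ ts {z z′ : State → Carrier} (h : State → Degrees) F F′ {K} →
            (∀ T → z T * F (h T) ≈ K * (z′ T * F′ (h T))) →
            ∑ (map (λ T → z T , h T) ts) F ≈ K * ∑ (map (λ T → z′ T , h T) ts) F′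
  ∑-scale []       h F F′ eq = sym (zeroʳ _)
  ∑-scale (T ∷ ts) h F F′ eq = trans (+-cong (eq T) (∑-scale ts h F F′ eq)) (sym (distribˡ _ _ _))

  untouched-cell : ∀ {x} w h → (∀ T → h T x ≡ 0) → Untouched x [ cell w h ]
  untouched-cell w h h≡0 = All.map⁺ {f = λ T → w T , h T} (All.universal h≡0 states) ∷ []

  -- Let consecutive cells k and k + 1 of a line share the vertex p (k + 1), which cell k covers
  -- leave T times and cell k + 1 enter T times.  These counts add up to 1, so the factors
  -- Δ ^ (1 ∸ leave T) and Δ ^ enter T of consecutive cells match, and only that at the first
  -- vertex remains.
  module Gauge (enter leave : State → ℕ) (leave≤1 : ∀ T → leave T ≤ 1) {N : ℕ} where

    -- `K` is the ratio already known for the factors after this line, and `Fresh` the condition on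
    -- the degrees under which it holds. The exponent depends on whether `p 0` is already covered,
    -- which is what a line cut off at its front must remember.
    Z-line : ∀ n {inc : ℕ → State → Degrees} {z z′ : ℕ → State → Carrier} {p : ℕ → Vertex}
      {fs fs′ : List Factor} {Δ K : Carrier} (Fresh : Degrees → Set) →
      (∀ k T k′ → inc k T (p k′) ≡ δ k k′ ℕ.* enter T ℕ.+ δ (suc k) k′ ℕ.* leave T) →
      (∀ k T → z k T * Δ ^ (1 ∸ leave T) ≈ Δ ^ enter T * z′ k T) →
      (∀ {g} k T → Fresh g → Fresh (g ⊕ inc k T)) →
      (∀ k → Untouched (p k) fs) → (∀ k → Untouched (p k) fs′) →
      (∀ g → Fresh g → Z N 𝟏 fs g ≈ K * Z N 𝟏 fs′ g) →
      (∀ {k} → k < suc n → p k ∈AD N) →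
      ∀ g → Fresh g → g (p 0) ≤ 1 → (∀ k → g (p (suc k)) ≡ 0) →
      Z N 𝟏 (line n z inc ++ fs) g ≈ Δ ^ (1 ∸ g (p 0)) * (K * Z N 𝟏 (line n z′ inc ++ fs′) g)
    Z-line zero {p = p} {fs} {fs′} {Δ} {K}
           Fresh inc-p law Fresh-⊕ fs-p fs′-p tail p∈ g fresh g≤1 g≡0
      with g (p 0) in eq
    -- At the end of the line nothing more can cover `p 0`: if it is uncovered both sides vanish,
    -- and if it is covered the exponent of `Δ` is 0.
    ... | 0 = trans (Z-stuck (p 0) (p∈ (s≤s z≤n)) (fs-p 0) g≢1)
      (sym (trans (*-congˡ (trans (*-congˡ (Z-stuck (p 0) (p∈ (s≤s z≤n)) (fs′-p 0) g≢1)) (zeroʳ K)))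
                  (zeroʳ _)))
      where
      g≢1 : g (p 0) ≢ 1
      g≢1 g≡1 with () ← ≡.trans (≡.sym eq) g≡1
    ... | 1 = trans (tail g fresh) (sym (*-identityˡ _))
    ... | suc (suc _) with s≤s () ← g≤1
    Z-line (suc n) {inc} {z} {z′} {p} {fs} {fs′} {Δ} {K}
           Fresh inc-p law Fresh-⊕ fs-p fs′-p tail p∈ g fresh g≤1 g≡0 =
      trans (∑-scale states (inc 0) (λ h → Z N 𝟏 rest (g ⊕ h)) (λ h → Z N 𝟏 rest′ (g ⊕ h)) step)
            (*-assoc _ _ _)
      where
      open ≈-Reasoning
      rest  = line n (z  ∘ suc) (inc ∘ suc) ++ fs
      rest′ = line n (z′ ∘ suc) (inc ∘ suc) ++ fs′
      inc-first : ∀ T → inc 0 T (p 0) ≡ enter T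
      inc-first T = ≡.trans (inc-p 0 T 0) (≡.trans (ℕ.+-identityʳ _) (ℕ.+-identityʳ _))
      inc-second : ∀ T → (g ⊕ inc 0 T) (p 1) ≡ leave T
      inc-second T = ≡.trans (cong₂ ℕ._+_ (g≡0 0) (inc-p 0 T 1)) (ℕ.+-identityʳ _)
      untouched-rest : ∀ w gs → (∀ k → Untouched (p k) gs) →
                       Untouched (p 0) (line n w (inc ∘ suc) ++ gs)
      untouched-rest w gs gs-p =
        All.++⁺ (All-concatUpTo n λ k →
                   untouched-cell (w k) (inc (suc k)) λ T → inc-p (suc k) T 0)
                (gs-p 0)
      ih : ∀ T → Z N 𝟏 rest (g ⊕ inc 0 T) ≈ Δ ^ (1 ∸ leave T) * (K * Z N 𝟏 rest′ (g ⊕ inc 0 T))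
      ih T = ≡.subst (λ m → Z N 𝟏 rest (g ⊕ inc 0 T) ≈ Δ ^ (1 ∸ m) * (K * Z N 𝟏 rest′ (g ⊕ inc 0 T)))
        (inc-second T)
        (Z-line n {inc ∘ suc} {p = p ∘ suc} Fresh (λ k T k′ → inc-p (suc k) T (suc k′))
          (law ∘ suc) (Fresh-⊕ ∘ suc) (fs-p ∘ suc) (fs′-p ∘ suc) tail (λ k< → p∈ (s≤s k<))
          (g ⊕ inc 0 T) (Fresh-⊕ 0 T fresh)
          (≡.subst (_≤ 1) (≡.sym (inc-second T)) (leave≤1 T))
          (λ k → cong₂ ℕ._+_ (g≡0 (suc k)) (inc-p 0 T (suc (suc k)))))
      step : ∀ T → z 0 T * Z N 𝟏 rest (g ⊕ inc 0 T) ≈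
                   (Δ ^ (1 ∸ g (p 0)) * K) * (z′ 0 T * Z N 𝟏 rest′ (g ⊕ inc 0 T))
      -- No later factor touches `p 0`, so only states that bring its degree to exactly 1
      -- contribute. For these `enter T` equals `1 ∸ g (p 0)`, the exponent in the claim.
      step T with g (p 0) ℕ.+ enter T ℕ.≟ 1
      ... | yes eq = begin
        z 0 T * Z N 𝟏 rest (g ⊕ inc 0 T)
          ≈⟨ *-congˡ (ih T) ⟩
        z 0 T * (Δ ^ (1 ∸ leave T) * (K * y))
          ≈⟨ *-assoc _ _ _ ⟨
        (z 0 T * Δ ^ (1 ∸ leave T)) * (K * y)
          ≈⟨ *-congʳ (law 0 T) ⟩
        (Δ ^ enter T * z′ 0 T) * (K * y)
          ≡⟨ cong (λ m → (Δ ^ m * z′ 0 T) * (K * y))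
               (≡.trans (≡.sym (ℕ.m+n∸m≡n (g (p 0)) (enter T))) (cong (_∸ g (p 0)) eq)) ⟩
        (Δ ^ (1 ∸ g (p 0)) * z′ 0 T) * (K * y)
          ≈⟨ solve 4 (λ d z k y → (d :* z) :* (k :* y) := (d :* k) :* (z :* y)) refl
               (Δ ^ (1 ∸ g (p 0))) (z′ 0 T) K y ⟩
        (Δ ^ (1 ∸ g (p 0)) * K) * (z′ 0 T * y) ∎
        where y = Z N 𝟏 rest′ (g ⊕ inc 0 T)
      ... | no ≢1 = trans (vanish (z 0 T) (untouched-rest (z ∘ suc) fs fs-p))
        (sym (trans (*-congˡ (vanish (z′ 0 T) (untouched-rest (z′ ∘ suc) fs′ fs′-p))) (zeroʳ _)))
        where
        vanish : ∀ y {gs} → Untouched (p 0) gs → y * Z N 𝟏 gs (g ⊕ inc 0 T) ≈ 0#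
        vanish y gs-p0 = trans (*-congˡ (Z-stuck (p 0) (p∈ (s≤s z≤n)) gs-p0
          λ eq → ≢1 (≡.trans (cong (g (p 0) ℕ.+_) (≡.sym (inc-first T))) eq))) (zeroʳ y)

    -- Cells of one line touch no vertex `p` of another, so the lines can be treated one by one.
    -- Each starts at an uncovered vertex and therefore contributes its `Δ` once.
    Z-lines : ∀ m n {inc : ℕ → ℕ → State → Degrees} {z z′ : ℕ → ℕ → State → Carrier}
      {p : ℕ → ℕ → Vertex} {Δ : ℕ → Carrier} →
      (∀ l k T l′ k′ → inc l k T (p l′ k′) ≡
                       δ l l′ ℕ.* (δ k k′ ℕ.* enter T ℕ.+ δ (suc k) k′ ℕ.* leave T)) →
      (∀ l k T → z l k T * Δ l ^ (1 ∸ leave T) ≈ Δ l ^ enter T * z′ l k T) →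
      (∀ {l k} → l < m → k < suc n → p l k ∈AD N) →
      ∀ g → (∀ l k → g (p l k) ≡ 0) →
      Z N 𝟏 (concatUpTo m λ l → line n (z l) (inc l)) g ≈
      ∏ m Δ * Z N 𝟏 (concatUpTo m λ l → line n (z′ l) (inc l)) g
    Z-lines zero    n inc-p law p∈ g g≡0 = sym (*-identityˡ _)
    Z-lines (suc m) n {inc} {z} {z′} {p} {Δ} inc-p law p∈ g g≡0 = begin
      Z N 𝟏 (line n (z 0) (inc 0) ++ concatUpTo m λ l → line n (z (suc l)) (inc (suc l))) g
        ≈⟨ Z-line n {inc 0} {z 0} {z′ 0} {p 0} Fresh
             (λ k T k′ → ≡.trans (inc-p 0 k T 0 k′) (ℕ.*-identityˡ _)) (law 0)
             (λ k T fresh l k′ → cong₂ ℕ._+_ (fresh l k′) (inc-p 0 k T (suc l) k′))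
             (untouched z) (untouched z′)
             -- The remaining lines supply the ratio `K`, as long as their own vertices are still
             -- uncovered.
             (Z-lines m n {inc ∘ suc} {p = p ∘ suc} (λ l k T l′ → inc-p (suc l) k T (suc l′))
               (law ∘ suc) (λ l< → p∈ (s≤s l<)))
             (p∈ (s≤s z≤n)) g (g≡0 ∘ suc)
             (≡.subst (_≤ 1) (≡.sym (g≡0 0 0)) z≤n) (λ k → g≡0 0 (suc k)) ⟩
      Δ 0 ^ (1 ∸ g (p 0 0)) * (∏ m (Δ ∘ suc) * y)
        ≡⟨ cong (λ k → Δ 0 ^ (1 ∸ k) * (∏ m (Δ ∘ suc) * y)) (g≡0 0 0) ⟩
      (Δ 0 * 1#) * (∏ m (Δ ∘ suc) * y)
        ≈⟨ *-congʳ (*-identityʳ (Δ 0)) ⟩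
      Δ 0 * (∏ m (Δ ∘ suc) * y)
        ≈⟨ *-assoc _ _ _ ⟨
      ∏ (suc m) Δ * y ∎
      where
      open ≈-Reasoning
      Fresh : Degrees → Set
      Fresh g = ∀ l k → g (p (suc l) k) ≡ 0
      y = Z N 𝟏 (line n (z′ 0) (inc 0) ++ concatUpTo m λ l → line n (z′ (suc l)) (inc (suc l))) g
      untouched : ∀ (w : ℕ → ℕ → State → Carrier) k →
                  Untouched (p 0 k) (concatUpTo m λ l → line n (w (suc l)) (inc (suc l)))
      untouched w k = All-concatUpTo m λ l → All-concatUpTo n λ k′ →
        untouched-cell (w (suc l) k′) (inc (suc l) k′) λ T → inc-p (suc l) k′ T 0 k

  -- The reduction theorem

  mirrored : (ℕ → ℕ → Carrier) → ℕ → ℕ → Carrier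
  mirrored A r s = A (mirror r) (mirror s)

  mirrored-nw : ∀ A i j → cellWeight (mirrored A) i j nw ≡ cellWeight A i j se
  mirrored-nw A i j = cong₂ A (mirror-even i) (mirror-even j)

  mirrored-ne : ∀ A i j → cellWeight (mirrored A) i j ne ≡ cellWeight A i j sw
  mirrored-ne A i j = cong₂ A (mirror-even i) (mirror-odd j)

  mirrored-sw : ∀ A i j → cellWeight (mirrored A) i j sw ≡ cellWeight A i j ne
  mirrored-sw A i j = cong₂ A (mirror-odd i) (mirror-even j)

  mirrored-se : ∀ A i j → cellWeight (mirrored A) i j se ≡ cellWeight A i j nw
  mirrored-se A i j = cong₂ A (mirror-odd i) (mirror-odd j)

  mirrored-full : ∀ A i j → cellWeight (mirrored A) i j full ≈ cellWeight A i j full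
  mirrored-full A i j
    rewrite mirrored-nw A i j | mirrored-ne A i j | mirrored-sw A i j | mirrored-se A i j =
    +-cong (*-comm _ _) (*-comm _ _)

  -- The law required by `Gauge`. For a single edge, `co` and the half turn cancel, and exactly one
  -- of `top` and `bottom` is 1, so the exponents agree. For `none` and `full` the cell weight takes
  -- the place of one `Δ`.
  mirrored-vertical : ∀ A i j {Δ} → cellWeight A i j full ≈ Δ → ∀ T →
    cellWeight A i j T * Δ ^ (1 ∸ bottom T) ≈ Δ ^ top T * cellWeight (mirrored A) i j (co T)
  mirrored-vertical A i j eq none =
    *-cong refl (trans (*-identityʳ _) (sym (trans (mirrored-full A i j) eq)))
  mirrored-vertical A i j eq nw rewrite mirrored-se A i j = *-comm _ _
  mirrored-vertical A i j eq ne rewrite mirrored-sw A i j = *-comm _ _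
  mirrored-vertical A i j eq sw rewrite mirrored-ne A i j = *-comm _ _
  mirrored-vertical A i j eq se rewrite mirrored-nw A i j = *-comm _ _
  mirrored-vertical A i j eq full = *-cong (trans eq (sym (*-identityʳ _))) refl

  mirrored-horizontal : ∀ A i j {Δ} → cellWeight A i j full ≈ Δ → ∀ T →
    cellWeight A i j T * Δ ^ (1 ∸ right T) ≈ Δ ^ left T * cellWeight (mirrored A) i j (co T)
  mirrored-horizontal A i j eq none =
    *-cong refl (trans (*-identityʳ _) (sym (trans (mirrored-full A i j) eq)))
  mirrored-horizontal A i j eq nw rewrite mirrored-se A i j = *-comm _ _
  mirrored-horizontal A i j eq ne rewrite mirrored-sw A i j = *-comm _ _
  mirrored-horizontal A i j eq sw rewrite mirrored-ne A i j = *-comm _ _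
  mirrored-horizontal A i j eq se rewrite mirrored-nw A i j = *-comm _ _
  mirrored-horizontal A i j eq full = *-cong (trans eq (sym (*-identityʳ _))) refl

  bottom≤1 : ∀ T → bottom T ≤ 1
  bottom≤1 none = z≤n
  bottom≤1 nw   = z≤n
  bottom≤1 ne   = z≤n
  bottom≤1 sw   = s≤s z≤n
  bottom≤1 se   = s≤s z≤n
  bottom≤1 full = s≤s z≤n

  right≤1 : ∀ T → right T ≤ 1
  right≤1 none = z≤n
  right≤1 nw   = z≤n
  right≤1 ne   = s≤s z≤n
  right≤1 sw   = z≤n
  right≤1 se   = s≤s z≤n
  right≤1 full = s≤s z≤n

  -- Each cell is turned by 180°, and the offset `suc` then drops the first row and column, leaving
  -- the array of the inner diamond.
  reduced : (ℕ → ℕ → Carrier) → ℕ → ℕ → Carrier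
  reduced A r s = mirrored A (suc r) (suc s)

  Z-mirrored : ∀ N A → Z (suc N) 𝟏 (cellArray (suc N) λ i j → cellWeight (mirrored A) i j ∘ co) ∅ ≈
                       aztecM N (reduced A)
  Z-mirrored N A = trans (Z-cellArray-complement N (cellWeight (mirrored A)))
                         (sym (aztecM-inner≈Z N (mirrored A)))

  reduction-rows : ∀ N A Δ → (∀ i j → cellWeight A i j full ≈ Δ i) →
                   aztecM (suc N) A ≈ ∏ (suc N) Δ * aztecM N (reduced A)
  reduction-rows N A Δ eq = begin
    aztecM (suc N) A
      ≈⟨ aztecM≈Z (suc N) A ⟩
    Z (suc N) 𝟏 (cellArray (suc N) (cellWeight A)) ∅
      -- Consecutive cells of a row share `V` vertices, at which `cellInc` already has the form that
      -- `Z-lines` asks for.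
      ≈⟨ Z-lines (suc N) (suc N) {cellInc} {p = V} (λ _ _ _ _ _ → ≡.refl)
           (λ i j → mirrored-horizontal A i j (eq i j)) _,_ ∅ (λ _ _ → ≡.refl) ⟩
    ∏ (suc N) Δ * Z (suc N) 𝟏 (cellArray (suc N) λ i j → cellWeight (mirrored A) i j ∘ co) ∅
      ≈⟨ *-congˡ (Z-mirrored N A) ⟩
    ∏ (suc N) Δ * aztecM N (reduced A) ∎
    where
    open ≈-Reasoning
    open Gauge left right right≤1

  reduction-columns : ∀ N A Δ → (∀ i j → cellWeight A i j full ≈ Δ j) →
                      aztecM (suc N) A ≈ ∏ (suc N) Δ * aztecM N (reduced A)
  reduction-columns N A Δ eq = begin
    aztecM (suc N) A
      ≈⟨ aztecM≈Z (suc N) A ⟩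
    Z (suc N) 𝟏 (cellArray (suc N) (cellWeight A)) ∅
      -- The cells are listed by columns, so that the lines are vertical and joined at `U` vertices;
      -- the order by rows is restored afterwards.
      ≈⟨ Z-↭ (concatUpTo-swap (suc N) (suc N) λ i j → [ cell (cellWeight A i j) (cellInc i j) ]) ∅ ⟩
    Z (suc N) 𝟏 (concatUpTo (suc N) λ j → line (suc N) (λ i → cellWeight A i j) (λ i → cellInc i j)) ∅
      ≈⟨ Z-lines (suc N) (suc N) {λ j i → cellInc i j} {p = λ j i → U i j}
           (λ j i T j′ i′ → ℕ.*-comm _ (δ j j′))
           (λ j i → mirrored-vertical A i j (eq i j)) (λ j< i< → i< , j<) ∅ (λ _ _ → ≡.refl) ⟩
    ∏ (suc N) Δ * Z (suc N) 𝟏 (concatUpTo (suc N) λ j →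
      line (suc N) (λ i → cellWeight (mirrored A) i j ∘ co) (λ i → cellInc i j)) ∅
      ≈⟨ *-congˡ (Z-↭ (concatUpTo-swap (suc N) (suc N) λ j i →
           [ cell (cellWeight (mirrored A) i j ∘ co) (cellInc i j) ]) ∅) ⟩
    ∏ (suc N) Δ * Z (suc N) 𝟏 (cellArray (suc N) λ i j → cellWeight (mirrored A) i j ∘ co) ∅
      ≈⟨ *-congˡ (Z-mirrored N A) ⟩
    ∏ (suc N) Δ * aztecM N (reduced A) ∎
    where
    open ≈-Reasoning
    open Gauge top bottom bottom≤1

  -- The weights B

  aztecM-cong : ∀ N {A A′ : ℕ → ℕ → Carrier} → (∀ r s → A r s ≡ A′ r s) → aztecM N A ≈ aztecM N A′
  aztecM-cong N A≡A′ = sumOver-cong (perfectMatchings (AD N)) λ S →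
    reflexive (cong (foldr _*_ 1#) (List.map-cong (λ (r , s) → A≡A′ (toℕ r) (toℕ s)) S))

  cellWeight-4+ˡ : ∀ {A : ℕ → ℕ → Carrier} → (∀ r s → A (4 ℕ.+ r) s ≡ A r s) →
                   ∀ i j → cellWeight A (2 ℕ.+ i) j full ≡ cellWeight A i j full
  cellWeight-4+ˡ 4+ i j =
    cong₂ _+_ (cong₂ _*_ (4+ (i ℕ.* 2) (j ℕ.* 2)) (4+ (suc (i ℕ.* 2)) (suc (j ℕ.* 2))))
              (cong₂ _*_ (4+ (i ℕ.* 2) (suc (j ℕ.* 2))) (4+ (suc (i ℕ.* 2)) (j ℕ.* 2)))

  cellWeight-4+ʳ : ∀ {A : ℕ → ℕ → Carrier} → (∀ r s → A r (4 ℕ.+ s) ≡ A r s) →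
                   ∀ i j → cellWeight A i (2 ℕ.+ j) full ≡ cellWeight A i j full
  cellWeight-4+ʳ 4+ i j =
    cong₂ _+_ (cong₂ _*_ (4+ (i ℕ.* 2) (j ℕ.* 2)) (4+ (suc (i ℕ.* 2)) (suc (j ℕ.* 2))))
              (cong₂ _*_ (4+ (i ℕ.* 2) (suc (j ℕ.* 2))) (4+ (suc (i ℕ.* 2)) (j ℕ.* 2)))

  reduced-4+ˡ : ∀ {A : ℕ → ℕ → Carrier} → (∀ r s → A (4 ℕ.+ r) s ≡ A r s) →
                ∀ r s → reduced A (4 ℕ.+ r) s ≡ reduced A r s
  reduced-4+ˡ 4+ r s = 4+ (mirror (suc r)) (mirror (suc s))

  reduced-4+ʳ : ∀ {A : ℕ → ℕ → Carrier} → (∀ r s → A r (4 ℕ.+ s) ≡ A r s) →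
                ∀ r s → reduced A r (4 ℕ.+ s) ≡ reduced A r s
  reduced-4+ʳ 4+ r s = 4+ (mirror (suc r)) (mirror (suc s))

  alternate : Carrier → Carrier → ℕ → Carrier
  alternate x y zero    = x
  alternate x y (suc n) = alternate y x n

  ∏-alternate : ∀ n x → ∏ (n ℕ.* 2) (alternate 1# x) ≈ x ^ n
  ∏-alternate zero    x = refl
  ∏-alternate (suc n) x = trans (*-identityˡ _) (*-congˡ (∏-alternate n x))

  module _ (a : Carrier) where

    D : Carrier
    D = 1# + a ^ 2

    b : ℕ → ℕ → Carrier
    b r s = lookup (lookup (B R a) (r mod 4)) (s mod 4)

    4+-mod : ∀ r → (4 ℕ.+ r) mod 4 ≡ r mod 4
    4+-mod r = Fin.fromℕ<-cong ((4 ℕ.+ r) % 4) (r % 4)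
      (≡.trans (cong (_% 4) (ℕ.+-comm 4 r)) ([m+n]%n≡m%n r 4)) (m%n<n (4 ℕ.+ r) 4) (m%n<n r 4)

    b-4+ˡ : ∀ r s → b (4 ℕ.+ r) s ≡ b r s
    b-4+ˡ r s = cong (λ k → lookup (lookup (B R a) k) (s mod 4)) (4+-mod r)

    b-4+ʳ : ∀ r s → b r (4 ℕ.+ s) ≡ b r s
    b-4+ʳ r s = cong (lookup (lookup (B R a) (r mod 4))) (4+-mod s)

    -- Period 4 in the edges is period 2 in the cells, so the four cells of one copy of `B` decide.
    b-columns : ∀ i j → cellWeight b i j full ≈ alternate 1# D j
    b-columns 0 0 = solve 1 (λ a → a :* con 0 :+ con 1 :* con 1 := con 1) refl a
    b-columns 0 1 = solve 1 (λ a → a :* a :+ con 1 :* con 1 := con 1 :+ a :* (a :* con 1)) refl a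
    b-columns 1 0 = solve 1 (λ a → con 0 :* a :+ con 1 :* con 1 := con 1) refl a
    b-columns 1 1 = solve 1 (λ a → a :* a :+ con 1 :* con 1 := con 1 :+ a :* (a :* con 1)) refl a
    b-columns 0 (suc (suc j)) = trans (reflexive (cellWeight-4+ʳ b-4+ʳ 0 j)) (b-columns 0 j)
    b-columns 1 (suc (suc j)) = trans (reflexive (cellWeight-4+ʳ b-4+ʳ 1 j)) (b-columns 1 j)
    b-columns (suc (suc i)) j = trans (reflexive (cellWeight-4+ˡ b-4+ˡ i j)) (b-columns i j)

    reduced-b-rows : ∀ i j → cellWeight (reduced b) i j full ≈ alternate D 1# i
    reduced-b-rows 0 0 = solve 1 (λ a → a :* a :+ con 1 :* con 1 := con 1 :+ a :* (a :* con 1)) refl a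
    reduced-b-rows 0 1 = solve 1 (λ a → a :* a :+ con 1 :* con 1 := con 1 :+ a :* (a :* con 1)) refl a
    reduced-b-rows 1 0 = solve 1 (λ a → con 0 :* a :+ con 1 :* con 1 := con 1) refl a
    reduced-b-rows 1 1 = solve 1 (λ a → a :* con 0 :+ con 1 :* con 1 := con 1) refl a
    reduced-b-rows 0 (suc (suc j)) =
      trans (reflexive (cellWeight-4+ʳ (reduced-4+ʳ {b} b-4+ʳ) 0 j)) (reduced-b-rows 0 j)
    reduced-b-rows 1 (suc (suc j)) =
      trans (reflexive (cellWeight-4+ʳ (reduced-4+ʳ {b} b-4+ʳ) 1 j)) (reduced-b-rows 1 j)
    reduced-b-rows (suc (suc i)) j =
      trans (reflexive (cellWeight-4+ˡ (reduced-4+ˡ {b} b-4+ˡ) i j)) (reduced-b-rows i j)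

    -- Two reductions fix the even indices and move the odd ones by 4, the period of `B`.
    reduced²-mod : ∀ r → mirror (suc (mirror (suc r))) mod 4 ≡ r mod 4
    reduced²-mod 0 = ≡.refl
    reduced²-mod 1 = ≡.refl
    reduced²-mod 2 = ≡.refl
    reduced²-mod 3 = ≡.refl
    reduced²-mod (suc (suc (suc (suc r)))) =
      ≡.trans (4+-mod (mirror (suc (mirror (suc r))))) (≡.trans (reduced²-mod r) (≡.sym (4+-mod r)))

    reduced²-b : ∀ r s → reduced (reduced b) r s ≡ b r s
    reduced²-b r s = cong₂ (λ k l → lookup (lookup (B R a) k) l) (reduced²-mod r) (reduced²-mod s)

    -- From size 2n + 2 the column step meets n + 1 columns of weight `D`; the row step at size 2n +
    -- 1 meets n + 1 rows of weight `D`, since both outer rows have it. The exponent grows by 2(n +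
    -- 1), from n(n + 1) to (n + 1)(n + 2). At size 0 only the empty matching is left.
    aztecM-b : ∀ n → aztecM (n ℕ.* 2) b ≈ D ^ (n ℕ.* suc n)
    aztecM-b zero    = +-identityʳ 1#
    aztecM-b (suc n) = begin
      aztecM (suc n ℕ.* 2) b
        ≈⟨ reduction-columns (suc (n ℕ.* 2)) b (alternate 1# D) b-columns ⟩
      ∏ (suc n ℕ.* 2) (alternate 1# D) * aztecM (suc (n ℕ.* 2)) (reduced b)
        ≈⟨ *-cong (∏-alternate (suc n) D)
                  (reduction-rows (n ℕ.* 2) (reduced b) (alternate D 1#) reduced-b-rows) ⟩
      -- The first row factor `D` is split off by computation, leaving an alternating product of
      -- even length.
      D ^ suc n * (D * ∏ (n ℕ.* 2) (alternate 1# D) * aztecM (n ℕ.* 2) (reduced (reduced b)))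
        ≈⟨ *-congˡ (*-cong (*-congˡ (∏-alternate n D))
                           (trans (aztecM-cong (n ℕ.* 2) reduced²-b) (aztecM-b n))) ⟩
      D ^ suc n * (D ^ suc n * D ^ (n ℕ.* suc n))
        ≈⟨ *-congˡ (^-homo-* D (suc n) (n ℕ.* suc n)) ⟨
      D ^ suc n * D ^ (suc n ℕ.+ n ℕ.* suc n)
        ≈⟨ ^-homo-* D (suc n) (suc n ℕ.+ n ℕ.* suc n) ⟨
      D ^ (suc n ℕ.+ (suc n ℕ.+ n ℕ.* suc n))
        ≡⟨ cong (D ^_) (ℕ-solve 1 (λ n → (κ 1 ⊞ n) ⊞ ((κ 1 ⊞ n) ⊞ n ⊠ (κ 1 ⊞ n)) ⩵
                                         (κ 1 ⊞ n) ⊠ (κ 2 ⊞ n)) ≡.refl n) ⟩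
      D ^ (suc n ℕ.* suc (suc n)) ∎
      where
      open ≈-Reasoning
      open Data.Nat.Solver.+-*-Solver
        renaming (solve to ℕ-solve; _:+_ to _⊞_; _:*_ to _⊠_; _:=_ to _⩵_; con to κ)

open import Data.Nat.Base using (_*_)

theorem7p1 : {c ℓ : Level} (R : CommutativeRing c ℓ) (a : CommutativeRing.Carrier R) →
    (n : ℕ) → n ≥ 1 →
    let open CommutativeRing R hiding (_*_) in
    let open Algebra.Properties.Semiring.Exp semiring in
    M R (AD (2 * n)) (periodicWeight (B R a) (2 * n)) ≈ (1# + a ^ 2) ^ (n * suc n)
theorem7p1 R a n _ = subst
  (λ N → M R (AD N) (periodicWeight (B R a) N) ≈ (1# + a ^ 2) ^ (n * suc n))
  -- The induction runs over `n * 2`, which unfolds two at a time; `periodicWeight (B R a)` agrees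
  -- with `b` by computation.
  (ℕ.*-comm n 2) (AztecPartitionFunction.aztecM-b R a n)
  where
  open CommutativeRing R hiding (_*_)
  open Algebra.Properties.Semiring.Exp semiring
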